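{- Let $n\ge 8$. Then the set $\{\eta(\Gamma(G)) : \Gamma(G) \text{ an unbalanced signed graph with } G\in B_n^{++}\}$ equals $\{0,1,2,\ldots,n-6\}$.
   Context: A signed graph $\Gamma(G)=(G,\sigma)$ consists of a simple graph $G$ and a map $\sigma:E(G)\to\{+,-\}$; its adjacency matrix has entry $\sigma(v_iv_j)$ for edges and $0$ otherwise, and $\eta(\Gamma(G))$ is the multiplicity of $0$ as an eigenvalue. A cycle is positive if it has an even number of negative edges; $\Gamma(G)$ is balanced if all its cycles are positive, and unbalanced otherwise. A bicyclic graph is a connected simple graph with $|E|=|V|+1$. The graph $\infty(p,q,1)$ ($p,q\ge3$) is obtained from vertex-disjoint cycles $C_p$, $C_q$ by identifying a vertex of $C_p$ with a vertex of $C_q$. $B_n^{++}$ is the set of bicyclic graphs on $n$ vertices obtained from some $\infty(p,q,1)$ by (possibly) attaching trees to some of its vertices. -}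

module Defs where

open import Data.Nat using (ℕ; zero; suc; _+_; _≤_; _<ᵇ_)
open import Data.Integer as ℤ using (ℤ; +_; -[1+_])
open import Data.Fin using (Fin; toℕ; punchIn) renaming (zero to fzero; suc to fsuc)
open import Data.Fin.Properties using (_≟_)
open import Data.Nat.ListAction using (sum)
open import Data.List using (List; []; _∷_; _++_; [_]; map; length; foldr; allFin)
open import Data.List.Membership.Propositional using (_∈_)
open import Data.List.Relation.Unary.Unique.Propositional using (Unique)
import Data.Product
open import Data.Product using (Σ; _×_; ∃; ∃-syntax)
open import Data.Sum using (_⊎_)
open import Data.Unit using (⊤)
open import Data.Bool using (if_then_else_)
open import Relation.Nullary using (¬_; does)
open import Relation.Binary.PropositionalEquality using (_≡_)

-- Signed graphs on the vertex set Fin n, given by their signed adjacency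
-- matrix: entries in {0,1,-1}, symmetric, zero diagonal.  The underlying
-- simple graph G has an edge ij iff the entry is nonzero; the sign of the
-- edge is the entry.

record SignedGraph (n : ℕ) : Set where
  field
    adj      : Fin n → Fin n → ℤ
    entries  : ∀ i j → adj i j ≡ + 0 ⊎ adj i j ≡ + 1 ⊎ adj i j ≡ -[1+ 0 ]
    symm     : ∀ i j → adj i j ≡ adj j i
    loopless : ∀ i → adj i i ≡ + 0
open SignedGraph public

module _ {n : ℕ} (Γ : SignedGraph n) where

  Adj : Fin n → Fin n → Set
  Adj i j = ¬ (adj Γ i j ≡ + 0)

  Chain : List (Fin n) → Set
  Chain (x ∷ y ∷ r) = Adj x y × Chain (y ∷ r)
  Chain _ = ⊤

  chainSign : List (Fin n) → ℤ
  chainSign (x ∷ y ∷ r) = adj Γ x y ℤ.* chainSign (y ∷ r)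
  chainSign _ = + 1

  data Walk : Fin n → Fin n → Set where
    here : ∀ {i} → Walk i i
    step : ∀ {i j k} → Adj i j → Walk j k → Walk i k

  Connected : Set
  Connected = ∀ i j → Walk i j

  record Cycle : Set where
    field
      vertices : List (Fin n)
      distinct : Unique vertices
      len≥3    : 3 ≤ length vertices
      closed   : Σ (Fin n) λ x → Σ (List (Fin n)) λ xs →
                   (vertices ≡ x ∷ xs) × Chain (x ∷ xs ++ [ x ])
  open Cycle public

  cycleSign : Cycle → ℤ
  cycleSign C with closed C
  ... | x Data.Product., xs Data.Product., _ = chainSign (x ∷ xs ++ [ x ])

  -- positive cycle: even number of negative edges, i.e. sign product +1
  Balanced : Set
  Balanced = (C : Cycle) → cycleSign C ≡ + 1

  Unbalanced : Set
  Unbalanced = ¬ Balanced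

  nz : ℤ → ℕ
  nz (+ 0) = 0
  nz _ = 1

  edgeCount : ℕ
  edgeCount = sum (map (λ i → sum (map (λ j →
                if toℕ i <ᵇ toℕ j then nz (adj Γ i j) else 0) (allFin n))) (allFin n))

  Bicyclic : Set
  Bicyclic = Connected × (edgeCount ≡ suc n)

  -- G ∈ B_n^{++}: G is bicyclic and contains two cycles C_p, C_q sharing
  -- exactly one vertex, i.e. G is ∞(p,q,1) with trees attached
  InBpp : Set
  InBpp = Bicyclic × Σ Cycle λ C₁ → Σ Cycle λ C₂ → Σ (Fin n) λ v →
            (v ∈ vertices C₁) × (v ∈ vertices C₂) ×
            (∀ w → w ∈ vertices C₁ → w ∈ vertices C₂ → w ≡ v)

-- Integer polynomials as coefficient lists (lowest degree first).

Poly : Set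
Poly = List ℤ

addP : Poly → Poly → Poly
addP [] q = q
addP p [] = p
addP (a ∷ p) (b ∷ q) = (a ℤ.+ b) ∷ addP p q

negP : Poly → Poly
negP = map (λ a → ℤ.- a)

mulP : Poly → Poly → Poly
mulP [] q = []
mulP (a ∷ p) q = addP (map (a ℤ.*_) q) (+ 0 ∷ mulP p q)

altSign : ℕ → Poly → Poly
altSign zero p = p
altSign (suc zero) p = negP p
altSign (suc (suc k)) p = altSign k p

det : ∀ {m} → (Fin m → Fin m → Poly) → Poly
det {zero} M = + 1 ∷ []
det {suc m} M = foldr addP []
  (map (λ j → altSign (toℕ j) (mulP (M fzero j) (det (λ r c → M (fsuc r) (punchIn j c)))))
       (allFin (suc m)))

charPoly : ∀ {n} → SignedGraph n → Poly
charPoly Γ = det (λ i j → if does (i ≟ j)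
                            then ℤ.- adj Γ i j ∷ + 1 ∷ []
                            else ℤ.- adj Γ i j ∷ [])

mult0 : Poly → ℕ
mult0 [] = 0
mult0 (+ 0 ∷ p) = suc (mult0 p)
mult0 (_ ∷ p) = 0

η : ∀ {n} → SignedGraph n → ℕ
η Γ = mult0 (charPoly Γ)

{-# OPTIONS --safe #-}
module Submission where

open import Defs
open import Data.Nat using (ℕ; _≤_; _∸_)
open import Data.Product using (Σ; _×_)
open import Function.Bundles using (_⇔_)
open import Relation.Binary.PropositionalEquality using (_≡_)

open import Data.Bool using (Bool; true; false; if_then_else_)
open import Data.Empty using (⊥; ⊥-elim)
open import Data.Fin using (Fin; zero; suc; toℕ; punchIn)
open import Data.Fin.Patterns using (0F; 1F; 2F; 3F; 4F)
open import Data.Fin.Permutation.Components using (transpose)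
open import Data.Fin.Properties using (_≟_; suc-injective; ¬∀⟶∃¬; all?)
open import Data.Integer as ℤ using (ℤ; +_; -[1+_]; _+_; _*_; -_; 0ℤ; 1ℤ; -1ℤ)
import Data.Integer.Properties as ℤₚ
open import Data.Integer.Tactic.RingSolver using (solve-∀)
open import Data.List as List using (List; []; _∷_; _++_; map; foldr; filter; length; allFin)
open import Data.List.Membership.DecPropositional using () renaming (_∈?_ to mem)
open import Data.List.Membership.Propositional using (_∈_; _∉_)
open import Data.List.Membership.Propositional.Properties
  using (∈-filter⁺; ∈-filter⁻; ∈-allFin; ∈-∃++; ∈-++⁺ˡ; ∈-++⁺ʳ; ∈-++⁻; ∈-map⁺; ∈-map⁻)
import Data.List.Properties as Listₚ
open import Data.List.Relation.Binary.Disjoint.Propositional using (Disjoint)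
import Data.List.Relation.Binary.Permutation.Propositional as Perm
open import Data.List.Relation.Binary.Permutation.Propositional
  using (_↭_; ↭-refl; ↭-trans; ↭-sym; prep)
import Data.List.Relation.Binary.Permutation.Propositional.Properties as Permₚ
open import Data.List.Relation.Binary.Permutation.Propositional.Properties
  using (shift; ∈-resp-↭; ↭-length; map⁺)
open import Data.List.Relation.Binary.Permutation.Setoid.Properties using (Unique-resp-↭)
open import Data.List.Relation.Binary.Subset.Propositional using (_⊆_)
open import Data.List.Relation.Unary.All as All using (All; []; _∷_)
open import Data.List.Relation.Unary.AllPairs using (AllPairs; []; _∷_)
open import Data.List.Relation.Unary.AllPairs.Properties using (tabulate⁺-<)
open import Data.List.Relation.Unary.Any using (here; there)
open import Data.List.Relation.Unary.Unique.Propositional using (Unique)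
import Data.List.Relation.Unary.Unique.Propositional.Properties as Uniqueₚ
open import Data.Nat as ℕ using (zero; suc; _<_; z≤n; s≤s; s≤s⁻¹)
open import Data.Nat.DivMod using (_divMod_; result)
open import Data.Nat.ListAction using () renaming (sum to Σℕ)
open import Data.Nat.ListAction.Properties using (sum-++; sum-↭)
import Data.Nat.Properties as ℕₚ
import Data.Nat.Tactic.RingSolver as ℕ-Solver
open import Data.Product using (_,_; proj₁; proj₂)
open import Data.Sum using (_⊎_; inj₁; inj₂; [_,_]′)
open import Data.Unit using (tt)
open import Data.Vec as Vec using (Vec; []; _∷_)
open import Data.Vec.Functional using (updateAt)
import Data.Vec.Functional.Properties as VFₚ
open import Function using (_∘_; const; id)
open import Function.Bundles using (mk⇔)
open import Relation.Binary.PropositionalEquality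
  using (_≢_; _≗_; refl; sym; trans; cong; cong₂; subst; setoid; module ≡-Reasoning)
open import Relation.Nullary using (¬_; yes; no; does; contradiction)
open import Relation.Nullary.Decidable
  using (¬?; dec-true; dec-false; decidable-stable; toWitness; _⊎-dec_)
open import Algebra.Properties.Semiring.Sum ℤₚ.+-*-semiring
  using (sum-cong-≗; ∑-distrib-+; ∑-comm; *-distribˡ-sum; sum-replicate-zero)
  renaming (sum to ∑)

-- Upper bound.  Deleting a vertex lowers the multiplicity of the root 0 of the
-- characteristic polynomial by at most one: if ψ is the vector of cofactors of a row of
-- x - A, then (x - A) ψ is a multiple of one basis vector, so if the polynomial vanishes
-- to high order then the coefficients of ψ form a Jordan chain of A at 0, and a symmetric
-- integer matrix has none.  It is therefore enough to find six vertices that induce a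
-- nonsingular subgraph, and three disjoint edges whose pendant ends can be peeled off one
-- after the other do.  They exist because a bicyclic graph has no edge besides those of
-- the two cycles and of the trees: if there is a tree vertex next to a cycle vertex, use
-- the edge between them, otherwise one of the cycles has length at least five.
--
-- Realization.  A leaf at h turns φ(G) into x φ(G) - φ(G - h), and φ(G - h) into
-- x φ(G - h).  If 0 is not a root of φ(G - h), then k + 1 leaves at h give nullity exactly
-- k.  Hanging paths of two vertices at h adjusts the number of vertices, and the two
-- negative triangles with a common vertex, with h that vertex or a leaf attached to it,
-- provide starting points of both parities.

-- Determinants as iterated contractions of exterior forms

-- Three obstacles shape the proof. `det` expands along the first row only, on coefficient lists,
-- whereas the argument needs expansion along any row and vanishing for equal rows. Contracting the
-- volume form by the rows one after another gives multilinearity at once and alternation from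
-- anticommutation; Laplace expansion along the first row then identifies the result with `det`.
-- Deleting vertices would change the index type at every step. A deleted vertex instead keeps its
-- place and has its row replaced by a unit row, which has the same determinant as the minor.
-- Bicyclicity is given by an edge count, not by a decomposition into cycles and trees, and no
-- decomposition is constructed. Each edge that must be excluded (between the cycles, a chord, a
-- second edge from a tree vertex) would yield a connected set of vertices with cyclomatic number
-- three. Such a set grows, by connectedness, to the whole graph and forces n + 2 edges. The number
-- six enters as follows: if the nullity exceeds n - 6, then after n - 6 deletions the constant
-- coefficient still vanishes, so every induced subgraph on six vertices is singular.

Series : Set
Series = ℕ → ℤ

-- (c , d) is the polynomial c + d x; _▷_ is multiplication by it.
Lin : Set
Lin = ℤ × ℤ

infixr 7 _▷_
_▷_ : Lin → Series → Series
((c , d) ▷ f) zero    = c * f zero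
((c , d) ▷ f) (suc j) = c * f (suc j) + d * f j

▷-cong : ∀ p {f g} → f ≗ g → p ▷ f ≗ p ▷ g
▷-cong (c , d) f≗g zero    = cong (c *_) (f≗g zero)
▷-cong (c , d) f≗g (suc j) = cong₂ (λ x y → c * x + d * y) (f≗g (suc j)) (f≗g j)

▷-+ : ∀ p f g j → (p ▷ (λ i → f i + g i)) j ≡ (p ▷ f) j + (p ▷ g) j
▷-+ (c , d) f g zero    = ℤₚ.*-distribˡ-+ c (f zero) (g zero)
▷-+ (c , d) f g (suc j) = eq c d (f (suc j)) (g (suc j)) (f j) (g j)
  where
  eq : ∀ c d x y z w → c * (x + y) + d * (z + w) ≡ (c * x + d * z) + (c * y + d * w)
  eq = solve-∀

▷-comm : ∀ p q f → p ▷ q ▷ f ≗ q ▷ p ▷ f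
▷-comm (c , d) (c′ , d′) f zero = eq c c′ (f zero)
  where
  eq : ∀ c c′ x → c * (c′ * x) ≡ c′ * (c * x)
  eq = solve-∀
▷-comm (c , d) (c′ , d′) f (suc zero) = eq c d c′ d′ (f 1) (f 0)
  where
  eq : ∀ c d c′ d′ x y → c * (c′ * x + d′ * y) + d * (c′ * y) ≡
                         c′ * (c * x + d * y) + d′ * (c * y)
  eq = solve-∀
▷-comm (c , d) (c′ , d′) f (suc (suc j)) = eq c d c′ d′ (f (suc (suc j))) (f (suc j)) (f j)
  where
  eq : ∀ c d c′ d′ x y z → c * (c′ * x + d′ * y) + d * (c′ * y + d′ * z) ≡
                           c′ * (c * x + d * y) + d′ * (c * y + d * z)
  eq = solve-∀

▷-zeroˡ : ∀ f j → ((0ℤ , 0ℤ) ▷ f) j ≡ 0ℤ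
▷-zeroˡ f zero    = refl
▷-zeroˡ f (suc j) = refl

▷-zeroʳ : ∀ p {f} → (∀ j → f j ≡ 0ℤ) → ∀ j → (p ▷ f) j ≡ 0ℤ
▷-zeroʳ (c , d) f≡0 zero    = trans (cong (c *_) (f≡0 zero)) (ℤₚ.*-zeroʳ c)
▷-zeroʳ (c , d) f≡0 (suc j) =
  trans (cong₂ (λ x y → c * x + d * y) (f≡0 (suc j)) (f≡0 j))
        (cong₂ _+_ (ℤₚ.*-zeroʳ c) (ℤₚ.*-zeroʳ d))

▷-const : ∀ c f j → ((c , 0ℤ) ▷ f) j ≡ c * f j
▷-const c f zero    = refl
▷-const c f (suc j) = ℤₚ.+-identityʳ _

▷-neg : ∀ f j → ((-1ℤ , 0ℤ) ▷ f) j ≡ - f j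
▷-neg f j = trans (▷-const -1ℤ f j) (ℤₚ.-1*i≡-i (f j))

▷-one : ∀ f j → ((1ℤ , 0ℤ) ▷ f) j ≡ f j
▷-one f j = trans (▷-const 1ℤ f j) (ℤₚ.*-identityˡ (f j))

-- Exterior forms in n variables whose coefficients are power series in x,
-- stored by the set of generators that occur.

Form : ℕ → Set
Form n = Vec Bool n → Series

infix 4 _≈_
_≈_ : ∀ {n} → Form n → Form n → Set
ω ≈ θ = ∀ s j → ω s j ≡ θ s j

infixl 6 _⊕_
_⊕_ : ∀ {n} → Form n → Form n → Form n
(ω ⊕ θ) s j = ω s j + θ s j

infixr 7 _•_
_•_ : ∀ {n} → Lin → Form n → Form n
(p • ω) s = p ▷ ω s

neg : ∀ {n} → Form n → Form n
neg ω = (-1ℤ , 0ℤ) • ω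

record Linear {m n} (F : Form m → Form n) : Set where
  field
    congruent : ∀ {ω θ} → ω ≈ θ → F ω ≈ F θ
    additive  : ∀ ω θ → F (ω ⊕ θ) ≈ F ω ⊕ F θ
    acts      : ∀ p ω → F (p • ω) ≈ p • F ω
  vanishes : ∀ {ω} → (∀ s j → ω s j ≡ 0ℤ) → ∀ s j → F ω s j ≡ 0ℤ
  vanishes {ω} ω≡0 s j = begin
    F ω s j                      ≡⟨ congruent (λ s j → trans (ω≡0 s j) (sym (▷-zeroˡ (ω s) j))) s j ⟩
    F ((0ℤ , 0ℤ) • ω) s j        ≡⟨ acts (0ℤ , 0ℤ) ω s j ⟩
    ((0ℤ , 0ℤ) ▷ F ω s) j        ≡⟨ ▷-zeroˡ (F ω s) j ⟩
    0ℤ                           ∎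
    where open ≡-Reasoning
  sums : ∀ {k} (p : Fin k → Lin) (ω : Fin k → Form m) s j →
         F (λ s j → ∑ λ i → (p i ▷ ω i s) j) s j ≡ ∑ λ i → (p i ▷ F (ω i) s) j
  sums {zero}  p ω s j = vanishes (λ _ _ → refl) s j
  sums {suc k} p ω s j =
    trans (additive (p zero • ω zero) _ s j)
          (cong₂ _+_ (acts (p zero) (ω zero) s j) (sums (p ∘ suc) (ω ∘ suc) s j))
open Linear

Row : ℕ → Set
Row n = Fin n → Lin

-- Contraction by a covector.
ι : ∀ {n} → Row n → Form n → Form n
ι {zero}  a ω s j = 0ℤ
ι {suc n} a ω (false ∷ s) j = ι (a ∘ suc) (ω ∘ (false ∷_)) s j + (a zero ▷ ω (true ∷ s)) j
ι {suc n} a ω (true ∷ s)    = (-1ℤ , 0ℤ) ▷ ι (a ∘ suc) (ω ∘ (true ∷_)) s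

ι-linear : ∀ {n} (a : Row n) → Linear (ι a)
ι-linear {zero} a = record
  { congruent = λ _ _ _ → refl
  ; additive  = λ _ _ _ _ → refl
  ; acts      = λ p _ _ j → sym (▷-zeroʳ p (λ _ → refl) j)
  }
ι-linear {suc n} a = record { congruent = cg ; additive = ad ; acts = ac }
  where
  module L = Linear (ι-linear (a ∘ suc))
  cg : ∀ {ω θ} → ω ≈ θ → ι a ω ≈ ι a θ
  cg ω≈θ (false ∷ s) j =
    cong₂ _+_ (L.congruent (λ s → ω≈θ (false ∷ s)) s j) (▷-cong (a zero) (ω≈θ (true ∷ s)) j)
  cg ω≈θ (true ∷ s) j = ▷-cong _ (L.congruent (λ s → ω≈θ (true ∷ s)) s) j
  ad : ∀ ω θ → ι a (ω ⊕ θ) ≈ ι a ω ⊕ ι a θ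
  ad ω θ (false ∷ s) j =
    trans (cong₂ _+_ (L.additive _ _ s j) (▷-+ (a zero) _ _ j))
          (eq (ι (a ∘ suc) (ω ∘ (false ∷_)) s j) _ _ _)
    where
    eq : ∀ x y z w → (x + y) + (z + w) ≡ (x + z) + (y + w)
    eq = solve-∀
  ad ω θ (true ∷ s) j =
    trans (▷-cong _ (L.additive _ _ s) j) (▷-+ (-1ℤ , 0ℤ) (ι (a ∘ suc) (ω ∘ (true ∷_)) s) _ j)
  ac : ∀ p ω → ι a (p • ω) ≈ p • ι a ω
  ac p ω (false ∷ s) j =
    trans (cong₂ _+_ (L.acts p _ s j) (▷-comm (a zero) p _ j)) (sym (▷-+ p _ _ j))
  ac p ω (true ∷ s) j = trans (▷-cong _ (L.acts p _ s) j) (▷-comm _ p _ j)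

ι-cong : ∀ {n} {a b : Row n} → a ≗ b → ∀ ω → ι a ω ≈ ι b ω
ι-cong {suc n} a≗b ω (false ∷ s) j =
  cong₂ _+_ (ι-cong (a≗b ∘ suc) _ s j) (cong (λ p → (p ▷ ω (true ∷ s)) j) (a≗b zero))
ι-cong {suc n} a≗b ω (true ∷ s) j = ▷-cong _ (ι-cong (a≗b ∘ suc) _ s) j
ι-cong {zero} a≗b ω s j = refl

-- The source of all alternation below. Where one of the two contractions removes the first
-- generator, the two mixed terms carry opposite signs, so exchanging `a` and `b` negates their sum;
-- the remaining terms follow by induction.
ι-anticomm : ∀ {n} (a b : Row n) ω → ι a (ι b ω) ≈ neg (ι b (ι a ω))
ι-anticomm {zero}  a b ω s j = sym (▷-zeroʳ (-1ℤ , 0ℤ) (λ _ → refl) j)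
ι-anticomm {suc n} a b ω (false ∷ s) j = begin
  ι a′ (ι b′ ω₀ ⊕ b zero • ω₁) s j + (a zero ▷ neg (ι b′ ω₁) s) j
    ≡⟨ cong₂ _+_ (expand a b) (negate a b) ⟩
  (ι a′ (ι b′ ω₀) s j + v) + - u
    ≡⟨ cong (λ x → (x + v) + - u) (trans (ι-anticomm a′ b′ ω₀ s j) (▷-neg _ j)) ⟩
  (- X + v) + - u
    ≡⟨ eq X v u ⟩
  - ((X + u) + - v)
    ≡⟨ cong -_ (cong₂ _+_ (expand b a) (negate b a)) ⟨
  - (ι b′ (ι a′ ω₀ ⊕ a zero • ω₁) s j + (b zero ▷ neg (ι a′ ω₁) s) j)
    ≡⟨ ▷-neg (ι b (ι a ω) (false ∷ s)) j ⟨
  neg (ι b (ι a ω)) (false ∷ s) j ∎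
  where
  open ≡-Reasoning
  a′ = a ∘ suc
  b′ = b ∘ suc
  ω₀ = ω ∘ (false ∷_)
  ω₁ = ω ∘ (true ∷_)
  X = ι b′ (ι a′ ω₀) s j
  v = (b zero ▷ ι a′ ω₁ s) j
  u = (a zero ▷ ι b′ ω₁ s) j
  eq : ∀ x v u → (- x + v) + - u ≡ - ((x + u) + - v)
  eq = solve-∀
  expand : ∀ a b → ι (a ∘ suc) (ι (b ∘ suc) ω₀ ⊕ b zero • ω₁) s j ≡
                   ι (a ∘ suc) (ι (b ∘ suc) ω₀) s j + (b zero ▷ ι (a ∘ suc) ω₁ s) j
  expand a b = trans (additive (ι-linear (a ∘ suc)) (ι (b ∘ suc) ω₀) (b zero • ω₁) s j)
                     (cong (_+_ (ι (a ∘ suc) (ι (b ∘ suc) ω₀) s j))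
                           (acts (ι-linear (a ∘ suc)) (b zero) ω₁ s j))
  negate : ∀ a b → (a zero ▷ neg (ι (b ∘ suc) ω₁) s) j ≡ - (a zero ▷ ι (b ∘ suc) ω₁ s) j
  negate a b = trans (▷-comm (a zero) _ _ j) (▷-neg _ j)
ι-anticomm {suc n} a b ω (true ∷ s) j =
  ▷-cong _ (λ i → begin
    ι (a ∘ suc) (neg (ι (b ∘ suc) ω₁)) s i
      ≡⟨ acts (ι-linear (a ∘ suc)) _ _ s i ⟩
    neg (ι (a ∘ suc) (ι (b ∘ suc) ω₁)) s i
      ≡⟨ ▷-cong _ (ι-anticomm (a ∘ suc) (b ∘ suc) ω₁ s) i ⟩
    neg (neg (ι (b ∘ suc) (ι (a ∘ suc) ω₁))) s i
      ≡⟨ ▷-cong _ (acts (ι-linear (b ∘ suc)) _ _ s) i ⟨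
    neg (ι (b ∘ suc) (neg (ι (a ∘ suc) ω₁))) s i ∎) j
  where
  open ≡-Reasoning
  ω₁ = ω ∘ (true ∷_)

δ : ∀ {n} → Fin n → Fin n → ℤ
δ zero    zero    = 1ℤ
δ zero    (suc j) = 0ℤ
δ (suc i) zero    = 0ℤ
δ (suc i) (suc j) = δ i j

δ-diag : ∀ {n} (i : Fin n) → δ i i ≡ 1ℤ
δ-diag zero    = refl
δ-diag (suc i) = δ-diag i

δ-off : ∀ {n} {i j : Fin n} → i ≢ j → δ i j ≡ 0ℤ
δ-off {i = zero}  {zero}  i≢j = ⊥-elim (i≢j refl)
δ-off {i = zero}  {suc j} i≢j = refl
δ-off {i = suc i} {zero}  i≢j = refl
δ-off {i = suc i} {suc j} i≢j = δ-off (i≢j ∘ cong suc)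

∑-zero : ∀ {n} {f : Fin n → ℤ} → (∀ i → f i ≡ 0ℤ) → ∑ f ≡ 0ℤ
∑-zero {n} f≡0 = trans (sum-cong-≗ f≡0) (sum-replicate-zero n)

∑-single : ∀ {n} (k : Fin n) {f : Fin n → ℤ} → (∀ i → i ≢ k → f i ≡ 0ℤ) → ∑ f ≡ f k
∑-single zero {f} off =
  trans (cong (_+_ (f zero)) (∑-zero (λ i → off (suc i) (λ ())))) (ℤₚ.+-identityʳ _)
∑-single (suc k) {f} off =
  trans (cong₂ _+_ (off zero (λ ())) (∑-single k (λ i i≢k → off (suc i) (i≢k ∘ suc-injective))))
        (ℤₚ.+-identityˡ _)

basis : ∀ {n} → Fin n → Row n
basis w i = δ w i , 0ℤ

ι-zero : ∀ {n} (a : Row n) → (∀ i → a i ≡ (0ℤ , 0ℤ)) → ∀ ω s j → ι a ω s j ≡ 0ℤ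
ι-zero {zero} a a≡0 ω s j = refl
ι-zero {suc n} a a≡0 ω (false ∷ s) j =
  cong₂ _+_ (ι-zero (a ∘ suc) (a≡0 ∘ suc) _ s j)
            (trans (cong (λ p → (p ▷ ω (true ∷ s)) j) (a≡0 zero)) (▷-zeroˡ (ω (true ∷ s)) j))
ι-zero {suc n} a a≡0 ω (true ∷ s) j =
  ▷-zeroʳ (-1ℤ , 0ℤ) (ι-zero (a ∘ suc) (a≡0 ∘ suc) _ s) j

ι-expand : ∀ {n} (a : Row n) ω s j → ι a ω s j ≡ ∑ λ w → (a w ▷ ι (basis w) ω s) j
ι-expand {zero}  a ω s j = refl
ι-expand {suc n} a ω (false ∷ s) j = begin
  ι (a ∘ suc) ω₀ s j + (a zero ▷ ω (true ∷ s)) j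
    ≡⟨ ℤₚ.+-comm _ ((a zero ▷ ω (true ∷ s)) j) ⟩
  (a zero ▷ ω (true ∷ s)) j + ι (a ∘ suc) ω₀ s j
    ≡⟨ cong₂ _+_ (▷-cong (a zero) head j)
         (trans (ι-expand (a ∘ suc) ω₀ s j) (sum-cong-≗ (λ w → ▷-cong (a (suc w)) (tail w) j))) ⟩
  (a zero ▷ ι (basis zero) ω (false ∷ s)) j +
    (∑ λ w → (a (suc w) ▷ ι (basis (suc w)) ω (false ∷ s)) j) ∎
  where
  open ≡-Reasoning
  ω₀ = ω ∘ (false ∷_)
  head : ω (true ∷ s) ≗ ι (basis zero) ω (false ∷ s)
  head i = sym (trans (cong₂ _+_ (ι-zero _ (λ _ → refl) ω₀ s i) (▷-one (ω (true ∷ s)) i))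
                      (ℤₚ.+-identityˡ _))
  tail : ∀ w → ι (basis w) ω₀ s ≗ ι (basis (suc w)) ω (false ∷ s)
  tail w i = sym (trans (cong (_+_ (ι (basis w) ω₀ s i)) (▷-zeroˡ (ω (true ∷ s)) i)) (ℤₚ.+-identityʳ _))
ι-expand {suc n} a ω (true ∷ s) j = begin
  ((-1ℤ , 0ℤ) ▷ ι (a ∘ suc) ω₁ s) j
    ≡⟨ trans (▷-neg _ j) (cong -_ (ι-expand (a ∘ suc) ω₁ s j)) ⟩
  - (∑ λ w → (a (suc w) ▷ ι (basis w) ω₁ s) j)
    ≡⟨ trans (sym (ℤₚ.-1*i≡-i _)) (*-distribˡ-sum -1ℤ (λ w → (a (suc w) ▷ ι (basis w) ω₁ s) j)) ⟩
  (∑ λ w → -1ℤ * (a (suc w) ▷ ι (basis w) ω₁ s) j)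
    ≡⟨ sum-cong-≗ (λ w → trans (sym (▷-const -1ℤ (a (suc w) ▷ ι (basis w) ω₁ s) j))
                               (▷-comm (-1ℤ , 0ℤ) (a (suc w)) _ j)) ⟩
  (∑ λ w → (a (suc w) ▷ ι (basis (suc w)) ω (true ∷ s)) j)
    ≡⟨ trans (cong (_+ rest) (▷-zeroʳ (a zero) head j)) (ℤₚ.+-identityˡ rest) ⟨
  (a zero ▷ ι (basis zero) ω (true ∷ s)) j +
    (∑ λ w → (a (suc w) ▷ ι (basis (suc w)) ω (true ∷ s)) j) ∎
  where
  open ≡-Reasoning
  ω₁ = ω ∘ (true ∷_)
  rest = ∑ λ w → (a (suc w) ▷ ι (basis (suc w)) ω (true ∷ s)) j
  head : ∀ i → ι (basis zero) ω (true ∷ s) i ≡ 0ℤ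
  head = ▷-zeroʳ _ (ι-zero _ (λ _ → refl) ω₁ s)

infix 4 _≋_
_≋_ : ∀ {k n} → (Fin k → Row n) → (Fin k → Row n) → Set
r ≋ r′ = ∀ i → r i ≗ r′ i

infixl 8 _[_≔_]
_[_≔_] : ∀ {k n} → (Fin k → Row n) → Fin k → Row n → Fin k → Row n
r [ u ≔ a ] = updateAt r u (const a)

≔-at : ∀ {k n} (r : Fin k → Row n) u a → (r [ u ≔ a ]) u ≡ a
≔-at r u a = VFₚ.updateAt-updates u r

≔-off : ∀ {k n} (r : Fin k → Row n) u a {i} → i ≢ u → (r [ u ≔ a ]) i ≡ r i
≔-off r u a {i} i≢u = VFₚ.updateAt-minimal i u r i≢u

contract : ∀ {k n} → (Fin k → Row n) → Form n → Form n
contract {zero}  r ω = ω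
contract {suc k} r ω = contract (r ∘ suc) (ι (r zero) ω)

contract-linear : ∀ {k n} (r : Fin k → Row n) → Linear (contract r)
contract-linear {zero} r = record
  { congruent = id ; additive = λ _ _ _ _ → refl ; acts = λ _ _ _ _ → refl }
contract-linear {suc k} r = record
  { congruent = C.congruent ∘ I.congruent
  ; additive  = λ ω θ s j → trans (C.congruent (I.additive ω θ) s j) (C.additive _ _ s j)
  ; acts      = λ p ω s j → trans (C.congruent (I.acts p ω) s j) (C.acts p _ s j)
  }
  where
  module I = Linear (ι-linear (r zero))
  module C = Linear (contract-linear (r ∘ suc))

contract-cong : ∀ {k n} {r r′ : Fin k → Row n} → r ≋ r′ → ∀ ω → contract r ω ≈ contract r′ ω
contract-cong {zero}  r≋r′ ω s j = refl
contract-cong {suc k} {r = r} r≋r′ ω s j =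
  trans (congruent (contract-linear (r ∘ suc)) (ι-cong (r≋r′ zero) ω) s j)
        (contract-cong (r≋r′ ∘ suc) _ s j)

contract-anticomm : ∀ {k n} (r : Fin k → Row n) a b ω →
                    contract r (ι a (ι b ω)) ≈ neg (contract r (ι b (ι a ω)))
contract-anticomm r a b ω s j =
  trans (congruent (contract-linear r) (ι-anticomm a b ω) s j)
        (acts (contract-linear r) _ (ι b (ι a ω)) s j)

-- Carrying `a` inward past `r zero` and `b` back outward costs a sign each, and these cancel. One
-- sign remains from the exchange where the two covectors are neighbours.
contract-exchange : ∀ {k n} (r : Fin k → Row n) i a b ω →
                    contract (r [ i ≔ b ]) (ι a ω) ≈ neg (contract (r [ i ≔ a ]) (ι b ω))
contract-exchange r zero a b ω s j = contract-anticomm (r ∘ suc) b a ω s j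
contract-exchange r (suc i) a b ω s j = begin
  contract (r′ [ i ≔ b ]) (ι (r zero) (ι a ω)) s j
    ≡⟨ contract-anticomm (r′ [ i ≔ b ]) (r zero) a ω s j ⟩
  neg (contract (r′ [ i ≔ b ]) (ι a (ι (r zero) ω))) s j
    ≡⟨ ▷-cong _ (contract-exchange r′ i a b (ι (r zero) ω) s) j ⟩
  neg (neg (contract (r′ [ i ≔ a ]) (ι b (ι (r zero) ω)))) s j
    ≡⟨ ▷-cong _ (contract-anticomm (r′ [ i ≔ a ]) (r zero) b ω s) j ⟨
  neg (contract (r′ [ i ≔ a ]) (ι (r zero) (ι b ω))) s j ∎
  where
  open ≡-Reasoning
  r′ = r ∘ suc

contract-swap : ∀ {k n} (r : Fin k → Row n) {i l} → i ≢ l → ∀ a b ω →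
                contract (r [ i ≔ a ] [ l ≔ b ]) ω ≈ neg (contract (r [ i ≔ b ] [ l ≔ a ]) ω)
contract-swap r {zero}  {zero}  i≢l a b ω s j = ⊥-elim (i≢l refl)
contract-swap r {zero}  {suc l} i≢l a b ω s j = contract-exchange (r ∘ suc) l a b ω s j
contract-swap r {suc i} {zero}  i≢l a b ω s j = contract-exchange (r ∘ suc) i b a ω s j
contract-swap r {suc i} {suc l} i≢l a b ω s j =
  contract-swap (r ∘ suc) (i≢l ∘ cong suc) a b (ι (r zero) ω) s j

contract-expand : ∀ {k n} (r : Fin k → Row n) u a ω s j →
  contract (r [ u ≔ a ]) ω s j ≡ ∑ λ w → (a w ▷ contract (r [ u ≔ basis w ]) ω s) j
contract-expand r zero a ω s j =
  trans (congruent (contract-linear (r ∘ suc)) (ι-expand a ω) s j)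
        (sums (contract-linear (r ∘ suc)) a (λ w → ι (basis w) ω) s j)
contract-expand r (suc u) a ω s j = contract-expand (r ∘ suc) u a (ι (r zero) ω) s j

unit : Series
unit zero    = 1ℤ
unit (suc j) = 0ℤ

-- The volume form. Contracting it by n rows leaves degree 0, so the determinant is read off at the
-- empty set of generators.
top : ∀ {n} → Form n
top []          = unit
top (false ∷ s) = λ _ → 0ℤ
top (true ∷ s)  = top s

∅ : ∀ {n} → Vec Bool n
∅ = Vec.replicate _ false

D : ∀ {n} → (Fin n → Row n) → Series
D r = contract r top ∅

module _ {n} (r : Fin n → Row n) where

  D-cong : ∀ {r′} → r ≋ r′ → D r ≗ D r′
  D-cong r≋r′ = contract-cong r≋r′ top ∅

  D-swap : ∀ {i l} → i ≢ l → ∀ a b j → D (r [ i ≔ a ] [ l ≔ b ]) j ≡ - D (r [ i ≔ b ] [ l ≔ a ]) j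
  D-swap i≢l a b j = trans (contract-swap r i≢l a b top ∅ j) (▷-neg _ j)

  D-expand : ∀ u a j → D (r [ u ≔ a ]) j ≡ ∑ λ w → (a w ▷ D (r [ u ≔ basis w ])) j
  D-expand u a = contract-expand r u a top ∅

≡-neg⇒≡0 : ∀ {x} → x ≡ - x → x ≡ 0ℤ
≡-neg⇒≡0 {+ zero}   eq = refl
≡-neg⇒≡0 {+ suc n}  ()
≡-neg⇒≡0 { -[1+ n ]} ()

≔-≔-self : ∀ {k n} (r : Fin k → Row n) {i l a b} → a ≗ r i → b ≗ r l → r [ i ≔ a ] [ l ≔ b ] ≋ r
≔-≔-self r {i} {l} {a} {b} a≗ b≗ m w with m ≟ l
... | yes refl rewrite ≔-at (r [ i ≔ a ]) l b = b≗ w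
... | no m≢l rewrite ≔-off (r [ i ≔ a ]) l b m≢l with m ≟ i
...   | yes refl rewrite ≔-at r i a = a≗ w
...   | no m≢i rewrite ≔-off r i a m≢i = refl

D-transpose : ∀ {n} (r r′ : Fin n → Row n) {i l} → i ≢ l → r′ i ≗ r l → r′ l ≗ r i →
              (∀ m → m ≢ i → m ≢ l → r′ m ≗ r m) → ∀ j → D r′ j ≡ - D r j
D-transpose r r′ {i} {l} i≢l r′i r′l r′m j = begin
  D r′ j                            ≡⟨ D-cong r′ into j ⟩
  D (r [ i ≔ r l ] [ l ≔ r i ]) j   ≡⟨ D-swap r i≢l (r l) (r i) j ⟩
  - D (r [ i ≔ r i ] [ l ≔ r l ]) j ≡⟨ cong -_ (D-cong _ (≔-≔-self r (λ _ → refl) (λ _ → refl)) j) ⟩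
  - D r j                           ∎
  where
  open ≡-Reasoning
  into : r′ ≋ r [ i ≔ r l ] [ l ≔ r i ]
  into m w with m ≟ l
  ... | yes refl rewrite ≔-at (r [ i ≔ r l ]) l (r i) = r′l w
  ... | no m≢l rewrite ≔-off (r [ i ≔ r l ]) l (r i) m≢l with m ≟ i
  ...   | yes refl rewrite ≔-at r i (r l) = r′i w
  ...   | no m≢i rewrite ≔-off r i (r l) m≢i = r′m m m≢i m≢l w

D-alternating : ∀ {n} (r : Fin n → Row n) {i l} → i ≢ l → r i ≗ r l → ∀ j → D r j ≡ 0ℤ
D-alternating r {i} {l} i≢l ri≗rl j =
  ≡-neg⇒≡0 (D-transpose r r i≢l ri≗rl (sym ∘ ri≗rl) (λ _ _ _ _ → refl) j)

-- A form in n generators read in n + 1 generators with `w` absent. Restriction of covectors along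
-- `punchIn w` corresponds to it, which is how the minors of `det` arise.
embed : ∀ {n} → Fin (suc n) → Form n → Form (suc n)
embed zero ω (false ∷ s) = ω s
embed zero ω (true ∷ s)  = λ _ → 0ℤ
embed {suc n} (suc w) ω (b ∷ s) = embed w (ω ∘ (b ∷_)) s

embed-∅ : ∀ {n} (w : Fin (suc n)) ω → embed w ω ∅ ≡ ω ∅
embed-∅ zero ω = refl
embed-∅ {suc n} (suc w) ω = embed-∅ w (ω ∘ (false ∷_))

embed-linear : ∀ {n} (w : Fin (suc n)) → Linear (embed w)
embed-linear w = record { congruent = cg w ; additive = ad w ; acts = ac w }
  where
  cg : ∀ {n} (w : Fin (suc n)) {ω θ} → ω ≈ θ → embed w ω ≈ embed w θ
  cg zero eq (false ∷ s) j = eq s j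
  cg zero eq (true ∷ s)  j = refl
  cg {suc n} (suc w) eq (b ∷ s) j = cg w (λ s → eq (b ∷ s)) s j
  ad : ∀ {n} (w : Fin (suc n)) ω θ → embed w (ω ⊕ θ) ≈ embed w ω ⊕ embed w θ
  ad zero ω θ (false ∷ s) j = refl
  ad zero ω θ (true ∷ s)  j = refl
  ad {suc n} (suc w) ω θ (b ∷ s) j = ad w (ω ∘ (b ∷_)) (θ ∘ (b ∷_)) s j
  ac : ∀ {n} (w : Fin (suc n)) p ω → embed w (p • ω) ≈ p • embed w ω
  ac zero p ω (false ∷ s) j = refl
  ac zero p ω (true ∷ s)  j = sym (▷-zeroʳ p (λ _ → refl) j)
  ac {suc n} (suc w) p ω (b ∷ s) j = ac w p (ω ∘ (b ∷_)) s j

ι-embed : ∀ {n} (a : Row (suc n)) w ω → ι a (embed w ω) ≈ embed w (ι (a ∘ punchIn w) ω)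
ι-embed a zero ω (false ∷ s) j =
  trans (cong (_+_ (ι (a ∘ suc) ω s j)) (▷-zeroʳ (a zero) (λ _ → refl) j)) (ℤₚ.+-identityʳ _)
ι-embed a zero ω (true ∷ s) j =
  ▷-zeroʳ (-1ℤ , 0ℤ) (vanishes (ι-linear (a ∘ suc)) (λ _ _ → refl) s) j
ι-embed {suc n} a (suc w) ω (false ∷ s) j = begin
  ι (a ∘ suc) (embed w ω₀) s j + (a zero ▷ embed w ω₁ s) j
    ≡⟨ cong₂ _+_ (ι-embed (a ∘ suc) w ω₀ s j) (sym (acts (embed-linear w) (a zero) ω₁ s j)) ⟩
  embed w (ι (a ∘ suc ∘ punchIn w) ω₀) s j + embed w (a zero • ω₁) s j
    ≡⟨ additive (embed-linear w) (ι (a ∘ suc ∘ punchIn w) ω₀) (a zero • ω₁) s j ⟨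
  embed w (ι (a ∘ suc ∘ punchIn w) ω₀ ⊕ a zero • ω₁) s j ∎
  where
  open ≡-Reasoning
  ω₀ = ω ∘ (false ∷_)
  ω₁ = ω ∘ (true ∷_)
ι-embed {suc n} a (suc w) ω (true ∷ s) j =
  trans (▷-cong _ (ι-embed (a ∘ suc) w ω₁ s) j) (sym (acts (embed-linear w) _ (ι (a ∘ suc ∘ punchIn w) ω₁) s j))
  where
  ω₁ = ω ∘ (true ∷_)

contract-embed : ∀ {k n} (r : Fin k → Row (suc n)) w ω →
                 contract r (embed w ω) ≈ embed w (contract (λ i → r i ∘ punchIn w) ω)
contract-embed {zero}  r w ω s j = refl
contract-embed {suc k} r w ω s j =
  trans (congruent (contract-linear (r ∘ suc)) (ι-embed (r zero) w ω) s j)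
        (contract-embed (r ∘ suc) w _ s j)

sign : ℕ → ℤ
sign zero          = 1ℤ
sign (suc zero)    = -1ℤ
sign (suc (suc k)) = sign k

sign-suc : ∀ k → sign (suc k) ≡ - sign k
sign-suc zero          = refl
sign-suc (suc zero)    = refl
sign-suc (suc (suc k)) = sign-suc k

-- To be removed, generator `w` passes the `toℕ w` generators before it; this is the sign of Laplace
-- expansion.
ι-basis-top : ∀ {n} (w : Fin (suc n)) → ι (basis w) top ≈ (sign (toℕ w) , 0ℤ) • embed w (top {n})
ι-basis-top zero (false ∷ s) j =
  trans (cong (_+ ((1ℤ , 0ℤ) ▷ top s) j)
              (vanishes (ι-linear (basis zero ∘ suc)) (λ _ _ → refl) s j))
        (ℤₚ.+-identityˡ _)
ι-basis-top zero (true ∷ s) j =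
  trans (▷-zeroʳ (-1ℤ , 0ℤ) (ι-zero _ (λ _ → refl) top s) j)
        (sym (▷-zeroʳ (1ℤ , 0ℤ) (λ _ → refl) j))
ι-basis-top {suc n} (suc w) (false ∷ s) j =
  trans (cong₂ _+_ (vanishes (ι-linear (basis w)) (λ _ _ → refl) s j) (▷-zeroˡ (top s) j))
        (sym (▷-zeroʳ _ (vanishes (embed-linear w) (λ _ _ → refl) s) j))
ι-basis-top {suc n} (suc w) (true ∷ s) j = begin
  ((-1ℤ , 0ℤ) ▷ ι (basis w) top s) j
    ≡⟨ ▷-neg _ j ⟩
  - ι (basis w) top s j
    ≡⟨ cong -_ (trans (ι-basis-top w s j) (▷-const (sign (toℕ w)) _ j)) ⟩
  - (sign (toℕ w) * embed w top s j)
    ≡⟨ ℤₚ.neg-distribˡ-* (sign (toℕ w)) _ ⟩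
  - sign (toℕ w) * embed w top s j
    ≡⟨ cong (_* embed w top s j) (sign-suc (toℕ w)) ⟨
  sign (suc (toℕ w)) * embed w top s j
    ≡⟨ ▷-const (sign (suc (toℕ w))) _ j ⟨
  ((sign (suc (toℕ w)) , 0ℤ) ▷ embed w top s) j ∎
  where open ≡-Reasoning

D-minor : ∀ {n} (r : Fin (suc n) → Row (suc n)) w j →
          D (r [ zero ≔ basis w ]) j ≡ sign (toℕ w) * D (λ i → r (suc i) ∘ punchIn w) j
D-minor {n} r w j = begin
  contract (r ∘ suc) (ι (basis w) top) ∅ j
    ≡⟨ congruent (contract-linear (r ∘ suc)) (ι-basis-top w) ∅ j ⟩
  contract (r ∘ suc) ((sign (toℕ w) , 0ℤ) • embed w top) ∅ j
    ≡⟨ acts (contract-linear (r ∘ suc)) (sign (toℕ w) , 0ℤ) (embed w top) ∅ j ⟩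
  ((sign (toℕ w) , 0ℤ) ▷ contract (r ∘ suc) (embed w top) ∅) j
    ≡⟨ ▷-const (sign (toℕ w)) _ j ⟩
  sign (toℕ w) * contract (r ∘ suc) (embed w top) ∅ j
    ≡⟨ cong (_*_ (sign (toℕ w))) (trans (contract-embed (r ∘ suc) w top ∅ j)
                                        (cong (λ f → f j) (embed-∅ w (contract (λ i → r (suc i) ∘ punchIn w) top)))) ⟩
  sign (toℕ w) * D (λ i → r (suc i) ∘ punchIn w) j ∎
  where open ≡-Reasoning

D-basis : ∀ {n} → D (basis {n}) zero ≡ 1ℤ
D-basis {zero}  = refl
D-basis {suc n} =
  trans (D-cong (basis {suc n}) {basis [ zero ≔ basis zero ]} into zero)
        (trans (D-minor {n} basis zero zero)
               (trans (ℤₚ.*-identityˡ (D (basis {n}) zero)) (D-basis {n})))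
  where
  into : basis {suc n} ≋ basis [ zero ≔ basis zero ]
  into zero    w = refl
  into (suc i) w = refl

-- Covectors that vanish on the first generator never remove it, so every term continues to contain
-- it.
contract-column : ∀ {k n} (r : Fin k → Row (suc n)) → (∀ i → r i zero ≡ (0ℤ , 0ℤ)) →
  ∀ ω → (∀ s j → ω (false ∷ s) j ≡ 0ℤ) → ∀ s j → contract r ω (false ∷ s) j ≡ 0ℤ
contract-column {zero}  r col ω ω₀ = ω₀
contract-column {suc k} r col ω ω₀ = contract-column (r ∘ suc) (col ∘ suc) _ λ s j →
  cong₂ _+_ (vanishes (ι-linear (r zero ∘ suc)) ω₀ s j)
            (trans (cong (λ p → (p ▷ ω (true ∷ s)) j) (col zero)) (▷-zeroˡ (ω (true ∷ s)) j))

D-column : ∀ {n} (r : Fin (suc n) → Row (suc n)) → (∀ i → r i zero ≡ (0ℤ , 0ℤ)) →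
           ∀ j → D r j ≡ 0ℤ
D-column r col = contract-column r col top (λ _ _ → refl) ∅

-- Characteristic polynomials

coef : Poly → Series
coef []      j       = 0ℤ
coef (a ∷ p) zero    = a
coef (a ∷ p) (suc j) = coef p j

coef-addP : ∀ p q j → coef (addP p q) j ≡ coef p j + coef q j
coef-addP []      q       j       = sym (ℤₚ.+-identityˡ _)
coef-addP (a ∷ p) []      j       = sym (ℤₚ.+-identityʳ _)
coef-addP (a ∷ p) (b ∷ q) zero    = refl
coef-addP (a ∷ p) (b ∷ q) (suc j) = coef-addP p q j

coef-map : ∀ {f : ℤ → ℤ} → f 0ℤ ≡ 0ℤ → ∀ p j → coef (map f p) j ≡ f (coef p j)
coef-map f0 []      j       = sym f0
coef-map f0 (a ∷ p) zero    = refl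
coef-map f0 (a ∷ p) (suc j) = coef-map f0 p j

coef-altSign : ∀ k p j → coef (altSign k p) j ≡ sign k * coef p j
coef-altSign zero          p j = sym (ℤₚ.*-identityˡ _)
coef-altSign (suc zero)    p j = trans (coef-map refl p j) (sym (ℤₚ.-1*i≡-i (coef p j)))
coef-altSign (suc (suc k)) p j = coef-altSign k p j

coef-zero : ∀ j → coef (0ℤ ∷ []) j ≡ 0ℤ
coef-zero zero    = refl
coef-zero (suc j) = refl

coef-constP : ∀ a q j → coef (mulP (a ∷ []) q) j ≡ a * coef q j
coef-constP a q j =
  trans (coef-addP (map (_*_ a) q) _ j)
        (trans (cong₂ _+_ (coef-map (ℤₚ.*-zeroʳ a) q j) (coef-zero j)) (ℤₚ.+-identityʳ _))

coef-linP : ∀ a b q j → coef (mulP (a ∷ b ∷ []) q) j ≡ ((a , b) ▷ coef q) j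
coef-linP a b q zero =
  trans (coef-addP (map (_*_ a) q) _ zero)
        (trans (cong (_+ 0ℤ) (coef-map (ℤₚ.*-zeroʳ a) q zero)) (ℤₚ.+-identityʳ _))
coef-linP a b q (suc j) =
  trans (coef-addP (map (_*_ a) q) _ (suc j))
        (cong₂ _+_ (coef-map (ℤₚ.*-zeroʳ a) q (suc j)) (coef-constP b q j))

coef-foldr : ∀ {m} {A : Set} (f : A → Poly) (g : Fin m → A) j →
             coef (foldr addP [] (map f (List.tabulate g))) j ≡ ∑ λ i → coef (f (g i)) j
coef-foldr {zero}  f g j = refl
coef-foldr {suc m} f g j =
  trans (coef-addP (f (g zero)) _ j) (cong (_+_ (coef (f (g zero)) j)) (coef-foldr f (g ∘ suc) j))

-- Entries are compared by their action on coefficient sequences, not as lists: diagonal entries are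
-- lists of two coefficients and the others lists of one, whereas a `Lin` always has two.
det-D : ∀ {n} (M : Fin n → Fin n → Poly) (r : Fin n → Row n) →
        (∀ i w q j → coef (mulP (M i w) q) j ≡ (r i w ▷ coef q) j) →
        ∀ j → coef (det M) j ≡ D r j
det-D {zero} M r M~r zero    = refl
det-D {zero} M r M~r (suc j) = refl
det-D {suc n} M r M~r j = begin
  coef (det M) j
    ≡⟨ coef-foldr (λ w → altSign (toℕ w) (mulP (M zero w) (det (minor w)))) id j ⟩
  (∑ λ w → coef (altSign (toℕ w) (mulP (M zero w) (det (minor w)))) j)
    ≡⟨ sum-cong-≗ (λ w → term w) ⟩
  (∑ λ w → (r zero w ▷ D (r [ zero ≔ basis w ])) j)
    ≡⟨ D-expand r zero (r zero) j ⟨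
  D r j ∎
  where
  open ≡-Reasoning
  minor : Fin (suc n) → Fin n → Fin n → Poly
  minor w i c = M (suc i) (punchIn w c)
  term : ∀ w → coef (altSign (toℕ w) (mulP (M zero w) (det (minor w)))) j ≡
               (r zero w ▷ D (r [ zero ≔ basis w ])) j
  term w = begin
    coef (altSign (toℕ w) (mulP (M zero w) (det (minor w)))) j
      ≡⟨ coef-altSign (toℕ w) _ j ⟩
    sign (toℕ w) * coef (mulP (M zero w) (det (minor w))) j
      ≡⟨ cong (_*_ (sign (toℕ w))) (M~r zero w (det (minor w)) j) ⟩
    sign (toℕ w) * (r zero w ▷ coef (det (minor w))) j
      ≡⟨ cong (_*_ (sign (toℕ w)))
              (▷-cong (r zero w) (det-D (minor w) _ (λ i c → M~r (suc i) (punchIn w c))) j) ⟩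
    sign (toℕ w) * (r zero w ▷ D (λ i → r (suc i) ∘ punchIn w)) j
      ≡⟨ ▷-const (sign (toℕ w)) (r zero w ▷ D (λ i → r (suc i) ∘ punchIn w)) j ⟨
    ((sign (toℕ w) , 0ℤ) ▷ r zero w ▷ D (λ i → r (suc i) ∘ punchIn w)) j
      ≡⟨ ▷-comm (sign (toℕ w) , 0ℤ) (r zero w) _ j ⟩
    (r zero w ▷ (sign (toℕ w) , 0ℤ) ▷ D (λ i → r (suc i) ∘ punchIn w)) j
      ≡⟨ ▷-cong (r zero w) (λ i → trans (▷-const (sign (toℕ w)) _ i) (sym (D-minor r w i))) j ⟩
    (r zero w ▷ D (r [ zero ≔ basis w ])) j ∎

charRow : ∀ {n} → SignedGraph n → Fin n → Row n
charRow Γ i w = - adj Γ i w , δ i w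

charPoly-D : ∀ {n} (Γ : SignedGraph n) j → coef (charPoly Γ) j ≡ D (charRow Γ) j
charPoly-D Γ = det-D _ (charRow Γ) entry
  where
  entry : ∀ i w q j →
    coef (mulP (if does (i ≟ w) then - adj Γ i w ∷ + 1 ∷ [] else - adj Γ i w ∷ []) q) j ≡
    (charRow Γ i w ▷ coef q) j
  entry i w q j with i ≟ w
  ... | yes refl rewrite δ-diag i = coef-linP (- adj Γ i i) 1ℤ q j
  ... | no i≢w rewrite δ-off i≢w =
    trans (coef-constP (- adj Γ i w) q j) (sym (▷-const (- adj Γ i w) (coef q) j))

coef-mult0 : ∀ p {j} → j < mult0 p → coef p j ≡ 0ℤ
coef-mult0 (+ zero ∷ p) {zero}  j<m = refl
coef-mult0 (+ zero ∷ p) {suc j} (s≤s j<m) = coef-mult0 p j<m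

mult0-unique : ∀ p k → (∀ j → j < k → coef p j ≡ 0ℤ) → coef p k ≢ 0ℤ → mult0 p ≡ k
mult0-unique []                k       low k≢0 = ⊥-elim (k≢0 refl)
mult0-unique (+ zero ∷ p)      zero    low k≢0 = ⊥-elim (k≢0 refl)
mult0-unique (+ zero ∷ p)      (suc k) low k≢0 =
  cong suc (mult0-unique p k (λ j j<k → low (suc j) (s≤s j<k)) k≢0)
mult0-unique (+ suc n ∷ p)     zero    low k≢0 = refl
mult0-unique (+ suc n ∷ p)     (suc k) low k≢0 with () ← low zero (s≤s z≤n)
mult0-unique ( -[1+ n ] ∷ p) zero    low k≢0 = refl
mult0-unique ( -[1+ n ] ∷ p) (suc k) low k≢0 with () ← low zero (s≤s z≤n)

-- Interlacing

private
  sq : ∀ x → Σ ℕ λ m → x * x ≡ + m × (m ≡ 0 → x ≡ 0ℤ)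
  sq (+ zero)   = 0 , refl , λ _ → refl
  sq (+ suc n)  = suc n ℕ.* suc n , refl , λ ()
  sq -[1+ n ]   = suc n ℕ.* suc n , refl , λ ()

  ∑-sq : ∀ {n} (x : Fin n → ℤ) →
         Σ ℕ λ m → (∑ λ i → x i * x i) ≡ + m × (m ≡ 0 → ∀ i → x i ≡ 0ℤ)
  ∑-sq {zero}  x = 0 , refl , λ _ ()
  ∑-sq {suc n} x with m , eq , h ← sq (x zero) | m′ , eq′ , t ← ∑-sq (x ∘ suc) =
    m ℕ.+ m′ , cong₂ _+_ eq eq′ ,
    λ { m+m′≡0 zero → h (ℕₚ.m+n≡0⇒m≡0 m m+m′≡0)
      ; m+m′≡0 (suc i) → t (ℕₚ.m+n≡0⇒n≡0 m m+m′≡0) i }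

∑-squares : ∀ {n} (x : Fin n → ℤ) → (∑ λ i → x i * x i) ≡ 0ℤ → ∀ i → x i ≡ 0ℤ
∑-squares x ∑≡0 with m , eq , zeros ← ∑-sq x = zeros (ℤₚ.+-injective (trans (sym eq) ∑≡0))

-- A symmetric matrix has no Jordan chain of length two at 0.
no-chain : ∀ {n} (A : Fin n → Fin n → ℤ) → (∀ i j → A i j ≡ A j i) → (x y : Fin n → ℤ) →
  (∀ r → (x r ≡ 0ℤ × y r ≡ 0ℤ) ⊎ ((∑ λ w → A r w * x w) ≡ 0ℤ × (∑ λ w → A r w * y w) ≡ x r)) →
  ∀ r → x r ≡ 0ℤ
no-chain A A-sym x y chain = ∑-squares x (begin
  (∑ λ r → x r * x r)                    ≡⟨ sum-cong-≗ lower ⟩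
  (∑ λ r → x r * ∑ λ w → A r w * y w)    ≡⟨ sum-cong-≗ (λ r → *-distribˡ-sum (x r) (λ w → A r w * y w)) ⟩
  (∑ λ r → ∑ λ w → x r * (A r w * y w))  ≡⟨ ∑-comm (λ r w → x r * (A r w * y w)) ⟩
  (∑ λ w → ∑ λ r → x r * (A r w * y w))  ≡⟨ sum-cong-≗ (λ w → trans
                                              (sum-cong-≗ (λ r → transposed r w))
                                              (sym (*-distribˡ-sum (y w) (λ r → A w r * x r)))) ⟩
  (∑ λ w → y w * ∑ λ r → A w r * x r)    ≡⟨ ∑-zero upper ⟩
  0ℤ ∎)
  where
  open ≡-Reasoning
  eq : ∀ x a y → x * (a * y) ≡ y * (a * x)
  eq = solve-∀
  transposed : ∀ r w → x r * (A r w * y w) ≡ y w * (A w r * x r)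
  transposed r w = trans (cong (λ a → x r * (a * y w)) (A-sym r w)) (eq (x r) (A w r) (y w))
  lower : ∀ r → x r * x r ≡ x r * ∑ λ w → A r w * y w
  lower r with chain r
  ... | inj₁ (xr , yr) rewrite xr = refl
  ... | inj₂ (Ax , Ay) = cong (_*_ (x r)) (sym Ay)
  upper : ∀ w → y w * (∑ λ r → A w r * x r) ≡ 0ℤ
  upper w with chain w
  ... | inj₁ (xw , yw) rewrite yw = refl
  ... | inj₂ (Ax , Ay) = trans (cong (_*_ (y w)) Ax) (ℤₚ.*-zeroʳ (y w))

module _ {n} (Γ : SignedGraph n) where

  -- The characteristic matrix of the subgraph induced on the complement of L,
  -- kept at size n by unit rows at L.
  del : List (Fin n) → Fin n → Row n
  del []      = charRow Γ
  del (u ∷ L) = del L [ u ≔ basis u ]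

  del-∉ : ∀ {L i} → i ∉ L → del L i ≡ charRow Γ i
  del-∉ {[]}    i∉ = refl
  del-∉ {u ∷ L} i∉ = trans (≔-off (del L) u (basis u) (i∉ ∘ here)) (del-∉ (i∉ ∘ there))

  del-∈ : ∀ {L i} → i ∈ L → del L i ≡ basis i
  del-∈ {u ∷ L} {i} i∈ with i ≟ u | i∈
  ... | yes refl | _          = ≔-at (del L) u (basis u)
  ... | no i≢u   | here i≡u   = ⊥-elim (i≢u i≡u)
  ... | no i≢u   | there i∈L  = trans (≔-off (del L) u (basis u) i≢u) (del-∈ i∈L)

  module _ (L : List (Fin n)) (u : Fin n) (u∉L : u ∉ L) where

    private
      ψ : Fin n → Series
      ψ w = D (del L [ u ≔ basis w ])

    -- Rows `r` and `u` are then the same unit row.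
    cofactor-∈ : ∀ {r} → r ∈ L → ∀ j → ψ r j ≡ 0ℤ
    cofactor-∈ {r} r∈L = D-alternating (del L [ u ≔ basis r ]) r≢u
      λ w → cong (λ a → a w) (trans (≔-off (del L) u (basis r) r≢u)
                             (trans (del-∈ r∈L) (sym (≔-at (del L) u (basis r)))))
      where
      r≢u : r ≢ u
      r≢u refl = u∉L r∈L

    -- The sum is the determinant with row `u` replaced by row `r` of x - A. For r = u this is
    -- `D (del L)`, otherwise two rows agree. Hence (x - A) ψ = φ e_u at the vertices outside `L`.
    cofactor-∉ : ∀ {r} → r ∉ L → ∀ j → D (del L) j ≡ 0ℤ →
                 (∑ λ w → (charRow Γ r w ▷ ψ w) j) ≡ 0ℤ
    cofactor-∉ {r} r∉L j φ≡0 = trans (sym (D-expand (del L) u (charRow Γ r) j)) row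
      where
      row : D (del L [ u ≔ charRow Γ r ]) j ≡ 0ℤ
      row with r ≟ u
      ... | yes refl = trans (D-cong _ (λ i w → cong (λ a → a w)
                           (VFₚ.updateAt-id-local u (del L) (sym (del-∉ r∉L)) i)) j) φ≡0
      ... | no r≢u = D-alternating _ r≢u
        (λ w → cong (λ a → a w) (trans (≔-off (del L) u (charRow Γ r) r≢u)
                                (trans (del-∉ r∉L) (sym (≔-at (del L) u (charRow Γ r))))))
        j

    private
      split₀ : ∀ r → (∑ λ w → (charRow Γ r w ▷ ψ w) 0) ≡ - (∑ λ w → adj Γ r w * ψ w 0)
      split₀ r = begin
        (∑ λ w → - adj Γ r w * ψ w 0)            ≡⟨ sum-cong-≗ (λ w → eq (adj Γ r w) (ψ w 0)) ⟩
        (∑ λ w → -1ℤ * (adj Γ r w * ψ w 0))      ≡⟨ *-distribˡ-sum -1ℤ (λ w → adj Γ r w * ψ w 0) ⟨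
        -1ℤ * (∑ λ w → adj Γ r w * ψ w 0)        ≡⟨ ℤₚ.-1*i≡-i _ ⟩
        - (∑ λ w → adj Γ r w * ψ w 0)            ∎
        where
        open ≡-Reasoning
        eq : ∀ a x → - a * x ≡ -1ℤ * (a * x)
        eq = solve-∀

      -- The coefficient of x^(j+1) in (x - A) ψ. Where it vanishes, A maps the coefficient vector
      -- ψ_(j+1) to ψ_j, which makes the chain.
      splitₛ : ∀ r j → (∑ λ w → (charRow Γ r w ▷ ψ w) (suc j)) ≡
                       - (∑ λ w → adj Γ r w * ψ w (suc j)) + ψ r j
      splitₛ r j = begin
        (∑ λ w → - adj Γ r w * ψ w (suc j) + δ r w * ψ w j)
          ≡⟨ ∑-distrib-+ (λ w → - adj Γ r w * ψ w (suc j)) (λ w → δ r w * ψ w j) ⟩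
        (∑ λ w → - adj Γ r w * ψ w (suc j)) + (∑ λ w → δ r w * ψ w j)
          ≡⟨ cong₂ _+_
               (trans (sum-cong-≗ (λ w → eq (adj Γ r w) (ψ w (suc j))))
                      (trans (sym (*-distribˡ-sum -1ℤ (λ w → adj Γ r w * ψ w (suc j)))) (ℤₚ.-1*i≡-i _)))
               (trans (∑-single r (λ w w≢r → cong (_* ψ w j) (δ-off (w≢r ∘ sym))))
                      (trans (cong (_* ψ r j) (δ-diag r)) (ℤₚ.*-identityˡ _))) ⟩
        - (∑ λ w → adj Γ r w * ψ w (suc j)) + ψ r j ∎
        where
        open ≡-Reasoning
        eq : ∀ a x → - a * x ≡ -1ℤ * (a * x)
        eq = solve-∀

    -- Induction on `j`: since ψ_(j-1) = 0, the vector ψ_j lies in the kernel of A off `L`, and it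
    -- is the image of ψ_(j+1), so `no-chain` kills it. At `L` both vectors vanish, which is the
    -- first alternative there. The equation for ψ_(j+1) uses one more coefficient of φ than the
    -- conclusion covers: this is the loss of one per deletion. At r = u the cofactor is the
    -- polynomial with `u` deleted as well.
    cofactors-vanish : ∀ k → (∀ j → j ≤ suc k → D (del L) j ≡ 0ℤ) →
                       ∀ j → j ≤ k → ∀ r → ψ r j ≡ 0ℤ
    cofactors-vanish k φ≡0 j j≤k =
      no-chain (adj Γ) (symm Γ) (λ r → ψ r j) (λ r → ψ r (suc j)) chain
      where
      current : ∀ j → j ≤ k → ∀ {r} → r ∉ L → (∑ λ w → adj Γ r w * ψ w j) ≡ 0ℤ
      current zero j≤k {r} r∉L =
        ℤₚ.neg-injective (trans (sym (split₀ r)) (cofactor-∉ r∉L 0 (φ≡0 0 z≤n)))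
      current (suc j) j≤k {r} r∉L = ℤₚ.neg-injective (begin
        - S        ≡⟨ ℤₚ.+-identityʳ (- S) ⟨
        - S + 0ℤ   ≡⟨ cong (_+_ (- S)) (cofactors-vanish k φ≡0 j (ℕₚ.<⇒≤ j≤k) r) ⟨
        - S + ψ r j ≡⟨ splitₛ r j ⟨
        (∑ λ w → (charRow Γ r w ▷ ψ w) (suc j)) ≡⟨ cofactor-∉ r∉L (suc j) (φ≡0 _ (ℕₚ.m≤n⇒m≤1+n j≤k)) ⟩
        0ℤ ∎)
        where
        open ≡-Reasoning
        S = ∑ λ w → adj Γ r w * ψ w (suc j)
      chain : ∀ r → (ψ r j ≡ 0ℤ × ψ r (suc j) ≡ 0ℤ) ⊎
                    ((∑ λ w → adj Γ r w * ψ w j) ≡ 0ℤ × (∑ λ w → adj Γ r w * ψ w (suc j)) ≡ ψ r j)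
      chain r with mem _≟_ r L
      ... | yes r∈L = inj₁ (cofactor-∈ r∈L j , cofactor-∈ r∈L (suc j))
      ... | no r∉L = inj₂ (current j j≤k r∉L , (begin
        S ≡⟨ eq S (ψ r j) ⟩
        ψ r j + - (- S + ψ r j) ≡⟨ cong (λ x → ψ r j + - x)
          (trans (sym (splitₛ r j)) (cofactor-∉ r∉L (suc j) (φ≡0 _ (s≤s j≤k)))) ⟩
        ψ r j + 0ℤ ≡⟨ ℤₚ.+-identityʳ _ ⟩
        ψ r j ∎))
        where
        open ≡-Reasoning
        S = ∑ λ w → adj Γ r w * ψ w (suc j)
        eq : ∀ s x → s ≡ x + - (- s + x)
        eq = solve-∀

  -- Cauchy interlacing for the multiplicity of the eigenvalue 0.
  interlace : ∀ L → Unique L → ∀ k → (∀ j → j ≤ List.length L ℕ.+ k → D (charRow Γ) j ≡ 0ℤ) →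
              ∀ j → j ≤ k → D (del L) j ≡ 0ℤ
  interlace []      uniq k φ≡0 = φ≡0
  interlace (u ∷ L) (u∉L ∷ uniq) k φ≡0 j j≤k =
    cofactors-vanish L u (λ u∈L → All.lookup u∉L u∈L refl) k
      (interlace L uniq (suc k) λ i i≤ → φ≡0 i (subst (i ≤_) (ℕₚ.+-suc _ k) i≤)) j j≤k u

-- Nonsingular induced subgraphs

∈-tail : ∀ {A : Set} {x y : A} {zs} → x ≢ y → y ∈ x ∷ zs → y ∈ zs
∈-tail x≢y (here y≡x) = contradiction (sym y≡x) x≢y
∈-tail x≢y (there y∈) = y∈

-- A nonzero entry of row `p` in another column `w` does no harm: row `w` is already a unit row, so
-- the cofactor there has two equal rows.
D-pivot : ∀ {n} (R : Fin n → Row n) p → (∀ w → w ≢ p → proj₁ (R p w) ≡ 0ℤ ⊎ R w ≗ basis w) →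
          D R 0 ≡ proj₁ (R p p) * D (R [ p ≔ basis p ]) 0
D-pivot R p cleared = begin
  D R 0                                              ≡⟨ D-cong R same 0 ⟩
  D (R [ p ≔ R p ]) 0                                ≡⟨ D-expand R p (R p) 0 ⟩
  (∑ λ w → (R p w ▷ D (R [ p ≔ basis w ])) 0)        ≡⟨ ∑-single p other ⟩
  proj₁ (R p p) * D (R [ p ≔ basis p ]) 0            ∎
  where
  open ≡-Reasoning
  same : R ≋ R [ p ≔ R p ]
  same i w = cong (λ a → a w) (sym (VFₚ.updateAt-id-local p R refl i))
  other : ∀ w → w ≢ p → proj₁ (R p w) * D (R [ p ≔ basis w ]) 0 ≡ 0ℤ
  other w w≢p with cleared w w≢p
  ... | inj₁ entry≡0 rewrite entry≡0 = refl
  ... | inj₂ Rw = trans (cong (_*_ (proj₁ (R p w))) (D-alternating _ w≢p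
        (λ i → trans (cong (λ a → a i) (≔-off R p (basis w) w≢p))
               (trans (Rw i) (cong (λ a → a i) (sym (≔-at R p (basis w)))))) 0))
        (ℤₚ.*-zeroʳ (proj₁ (R p w)))

-- Elimination in the order of `Ps`: each row vanishes at the positions that come after it, and
-- those before it already carry unit rows, so only the diagonal entry survives. `proj₁` appears
-- because only x = 0 matters.
nonsingular : ∀ {n} (Ps : List (Fin n)) (R : Fin n → Row n) →
  AllPairs (λ p q → p ≢ q × proj₁ (R p q) ≡ 0ℤ) Ps → All (λ p → proj₁ (R p p) ≢ 0ℤ) Ps →
  (∀ w → w ∈ Ps ⊎ R w ≗ basis w) → D R 0 ≢ 0ℤ
nonsingular {n} [] R triangular diagonal rest D≡0 = contradiction (begin
  1ℤ              ≡⟨ D-basis {n} ⟨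
  D (basis {n}) 0 ≡⟨ D-cong R identity 0 ⟨
  D R 0           ≡⟨ D≡0 ⟩
  0ℤ              ∎) λ ()
  where
  open ≡-Reasoning
  identity : R ≋ basis
  identity w with inj₂ eq ← rest w = eq
nonsingular {n} (p ∷ Ps) R (row ∷ triangular) (pivot ∷ diagonal) rest D≡0
  with ℤₚ.i*j≡0⇒i≡0∨j≡0 (proj₁ (R p p)) (trans (sym (D-pivot R p λ w w≢p →
         [ (λ w∈ → inj₁ (proj₂ (All.lookup row (∈-tail (w≢p ∘ sym) w∈)))) , inj₂ ]′ (rest w))) D≡0)
... | inj₁ pivot≡0 = pivot pivot≡0
... | inj₂ D′≡0 = nonsingular Ps R′ (rows row triangular) (diag row diagonal) done D′≡0
  where
  R′ = R [ p ≔ basis p ]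
  unchanged : ∀ {q} → p ≢ q → R′ q ≡ R q
  unchanged p≢q = ≔-off R p (basis p) (p≢q ∘ sym)
  rows : ∀ {Ps} → All (λ q → p ≢ q × proj₁ (R p q) ≡ 0ℤ) Ps →
         AllPairs (λ p q → p ≢ q × proj₁ (R p q) ≡ 0ℤ) Ps →
         AllPairs (λ p q → p ≢ q × proj₁ (R′ p q) ≡ 0ℤ) Ps
  rows [] [] = []
  rows ((p≢q , _) ∷ row) (r ∷ rs) =
    All.map (λ { (q≢ , eq) → q≢ , trans (cong (λ a → proj₁ (a _)) (unchanged p≢q)) eq }) r ∷ rows row rs
  diag : ∀ {Ps} → All (λ q → p ≢ q × proj₁ (R p q) ≡ 0ℤ) Ps →
         All (λ q → proj₁ (R q q) ≢ 0ℤ) Ps → All (λ q → proj₁ (R′ q q) ≢ 0ℤ) Ps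
  diag [] [] = []
  diag ((p≢q , _) ∷ row) (q≢0 ∷ qs) =
    (λ eq → q≢0 (trans (cong (λ a → proj₁ (a _)) (sym (unchanged p≢q))) eq)) ∷ diag row qs
  done : ∀ w → w ∈ Ps ⊎ R′ w ≗ basis w
  done w with w ≟ p | rest w
  ... | yes refl | _               = inj₂ λ i → cong (λ a → a i) (≔-at R p (basis p))
  ... | no w≢p   | inj₁ (here eq)  = contradiction eq w≢p
  ... | no w≢p   | inj₁ (there w∈) = inj₁ w∈
  ... | no w≢p   | inj₂ eq         =
    inj₂ λ i → trans (cong (λ a → a i) (≔-off R p (basis p) w≢p)) (eq i)

transpose-left : ∀ {n} (i l : Fin n) → transpose i l i ≡ l
transpose-left i l rewrite dec-true (i ≟ i) refl = refl

transpose-right : ∀ {n} (i l : Fin n) → transpose i l l ≡ i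
transpose-right i l with l ≟ i
... | yes l≡i = l≡i
... | no _ rewrite dec-true (l ≟ l) refl = refl

transpose-other : ∀ {n} (i l : Fin n) {m} → m ≢ i → m ≢ l → transpose i l m ≡ m
transpose-other i l {m} m≢i m≢l rewrite dec-false (m ≟ i) m≢i | dec-false (m ≟ l) m≢l = refl

D-transpose-rows : ∀ {n} (r : Fin n → Row n) {i l} → i ≢ l → ∀ j → D (r ∘ transpose i l) j ≡ - D r j
D-transpose-rows r {i} {l} i≢l = D-transpose r (r ∘ transpose i l) i≢l
  (λ w → cong (λ m → r m w) (transpose-left i l)) (λ w → cong (λ m → r m w) (transpose-right i l))
  (λ m m≢i m≢l w → cong (λ m → r m w) (transpose-other i l m≢i m≢l))

unique-⊆⇒↭ : ∀ {A : Set} {xs ys : List A} → Unique xs → xs ⊆ ys → Σ (List A) λ zs → ys ↭ xs ++ zs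
unique-⊆⇒↭ {xs = []}     {ys} _ _ = ys , ↭-refl
unique-⊆⇒↭ {xs = x ∷ xs} {ys} (x∉ ∷ uniq) xs⊆ys
  with as , bs , refl ← ∈-∃++ (xs⊆ys (here refl))
  with zs , perm ← unique-⊆⇒↭ {ys = as ++ bs} uniq
    (λ y∈ → ∈-tail (All.lookup x∉ y∈) (∈-resp-↭ (shift x as bs) (xs⊆ys (there y∈))))
  = zs , ↭-trans (shift x as bs) (prep x perm)

unique⇒length≤ : ∀ {n} {xs : List (Fin n)} → Unique xs → length xs ≤ n
unique⇒length≤ {n} {xs} uniq with zs , perm ← unique-⊆⇒↭ uniq (λ {x} _ → ∈-allFin x) =
  subst (length xs ≤_) (trans (sym (Listₚ.length-++ xs)) (trans (sym (↭-length perm)) (Listₚ.length-tabulate id)))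
        (ℕₚ.m≤m+n (length xs) (length zs))

module Adjacency {n} (Γ : SignedGraph n) where

  infix 4 _∼_ _≁_
  _∼_ _≁_ : Fin n → Fin n → Set
  i ∼ j = Adj Γ i j
  i ≁ j = adj Γ i j ≡ 0ℤ

  ≁-sym : ∀ {i j} → i ≁ j → j ≁ i
  ≁-sym {i} {j} eq = trans (symm Γ j i) eq

  ∼-sym : ∀ {i j} → i ∼ j → j ∼ i
  ∼-sym i∼j = i∼j ∘ ≁-sym

  -- Three disjoint edges uᵢwᵢ with each uᵢ adjacent to no later vertex: peeling off
  -- pendant vertices, the subgraph induced on them is nonsingular.
  pendant-matching : ∀ {u₁ w₁ u₂ w₂ u₃ w₃} →
    Unique (u₁ ∷ w₁ ∷ u₂ ∷ w₂ ∷ u₃ ∷ w₃ ∷ []) → u₁ ∼ w₁ → u₂ ∼ w₂ → u₃ ∼ w₃ →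
    u₁ ≁ u₂ → u₁ ≁ w₂ → u₁ ≁ u₃ → u₁ ≁ w₃ → u₂ ≁ u₃ → u₂ ≁ w₃ →
    ¬ (∀ j → j ℕ.+ 6 ≤ n → D (charRow Γ) j ≡ 0ℤ)
  pendant-matching {u₁} {w₁} {u₂} {w₂} {u₃} {w₃}
    uniq@((u₁w₁ ∷ u₁u₂ ∷ u₁w₂ ∷ u₁u₃ ∷ u₁w₃ ∷ []) ∷ (w₁u₂ ∷ w₁w₂ ∷ w₁u₃ ∷ w₁w₃ ∷ []) ∷
     (u₂w₂ ∷ u₂u₃ ∷ u₂w₃ ∷ []) ∷ (w₂u₃ ∷ w₂w₃ ∷ []) ∷ (u₃w₃ ∷ []) ∷ [] ∷ [])
    e₁ e₂ e₃ u₁≁u₂ u₁≁w₂ u₁≁u₃ u₁≁w₃ u₂≁u₃ u₂≁w₃ φ≡0 =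
    nonsingular Ps R triangular diagonal rest DR≡0
    where
    six = u₁ ∷ w₁ ∷ u₂ ∷ w₂ ∷ u₃ ∷ w₃ ∷ []
    outside? = λ i → ¬? (mem _≟_ i six)
    L = filter outside? (allFin n)
    L-unique : Unique L
    L-unique = Uniqueₚ.filter⁺ outside? (Uniqueₚ.allFin⁺ n)
    ∈L⇒∉six : ∀ {i} → i ∈ L → i ∉ six
    ∈L⇒∉six i∈L = proj₂ (∈-filter⁻ outside? {xs = allFin n} i∈L)
    L-length : length L ℕ.+ 6 ≤ n
    L-length = subst (_≤ n) (Listₚ.length-++ L)
      (unique⇒length≤ (Uniqueₚ.++⁺ L-unique uniq λ (i∈L , i∈six) → ∈L⇒∉six i∈L i∈six))
    R₀ = del Γ L
    -- Exchanging the rows of the two ends of each edge brings all six entries of the matching onto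
    -- the diagonal.
    R₁ = R₀ ∘ transpose u₁ w₁
    R₂ = R₁ ∘ transpose u₂ w₂
    R  = R₂ ∘ transpose u₃ w₃
    DR₀≡0 : D R₀ 0 ≡ 0ℤ
    DR₀≡0 = interlace Γ L L-unique 0
      (λ j j≤ → φ≡0 j (ℕₚ.≤-trans (ℕₚ.+-monoˡ-≤ 6 (subst (j ≤_) (ℕₚ.+-identityʳ _) j≤)) L-length)) 0 z≤n
    DR≡0 : D R 0 ≡ 0ℤ
    DR≡0 = trans (D-transpose-rows R₂ u₃w₃ 0) (cong -_ (trans (D-transpose-rows R₁ u₂w₂ 0)
             (cong -_ (trans (D-transpose-rows R₀ u₁w₁ 0) (cong -_ DR₀≡0)))))
    π : Fin n → Fin n
    π i = transpose u₁ w₁ (transpose u₂ w₂ (transpose u₃ w₃ i))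
    πu₁ : π u₁ ≡ w₁
    πu₁ rewrite transpose-other u₃ w₃ u₁u₃ u₁w₃ | transpose-other u₂ w₂ u₁u₂ u₁w₂ = transpose-left u₁ w₁
    πw₁ : π w₁ ≡ u₁
    πw₁ rewrite transpose-other u₃ w₃ w₁u₃ w₁w₃ | transpose-other u₂ w₂ w₁u₂ w₁w₂ = transpose-right u₁ w₁
    πu₂ : π u₂ ≡ w₂
    πu₂ rewrite transpose-other u₃ w₃ u₂u₃ u₂w₃ | transpose-left u₂ w₂ =
      transpose-other u₁ w₁ (u₁w₂ ∘ sym) (w₁w₂ ∘ sym)
    πw₂ : π w₂ ≡ u₂
    πw₂ rewrite transpose-other u₃ w₃ w₂u₃ w₂w₃ | transpose-right u₂ w₂ =
      transpose-other u₁ w₁ (u₁u₂ ∘ sym) (w₁u₂ ∘ sym)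
    πu₃ : π u₃ ≡ w₃
    πu₃ rewrite transpose-left u₃ w₃ | transpose-other u₂ w₂ (u₂w₃ ∘ sym) (w₂w₃ ∘ sym) =
      transpose-other u₁ w₁ (u₁w₃ ∘ sym) (w₁w₃ ∘ sym)
    πw₃ : π w₃ ≡ u₃
    πw₃ rewrite transpose-right u₃ w₃ | transpose-other u₂ w₂ (u₂u₃ ∘ sym) (w₂u₃ ∘ sym) =
      transpose-other u₁ w₁ (u₁u₃ ∘ sym) (w₁u₃ ∘ sym)
    entry : ∀ p q {i} → π p ≡ i → i ∈ six → proj₁ (R p q) ≡ - adj Γ i q
    entry p q refl i∈six = cong (λ a → proj₁ (a q)) (del-∉ Γ λ i∈L → ∈L⇒∉six i∈L i∈six)
    zero-entry : ∀ p q {i} → π p ≡ i → i ∈ six → i ≁ q → proj₁ (R p q) ≡ 0ℤ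
    zero-entry p q πp i∈ i≁q = trans (entry p q πp i∈) (cong -_ i≁q)
    pivot : ∀ p {i} → π p ≡ i → i ∈ six → i ∼ p → proj₁ (R p p) ≢ 0ℤ
    pivot p πp i∈ i∼p eq = i∼p (ℤₚ.neg-injective (trans (sym (entry p p πp i∈)) eq))
    m₁ : u₁ ∈ six
    m₁ = here refl
    m₂ : w₁ ∈ six
    m₂ = there (here refl)
    m₃ : u₂ ∈ six
    m₃ = there (there (here refl))
    m₄ : w₂ ∈ six
    m₄ = there (there (there (here refl)))
    m₅ : u₃ ∈ six
    m₅ = there (there (there (there (here refl))))
    m₆ : w₃ ∈ six
    m₆ = there (there (there (there (there (here refl)))))
    -- After the exchanges, row `w₁` lists the neighbours of `u₁`, and so on. The pendant ends are
    -- eliminated first in the order of peeling, then their partners in the reverse order, so that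
    -- every required zero is one of the assumed non-adjacencies or a zero of the diagonal.
    Ps = w₁ ∷ w₂ ∷ w₃ ∷ u₃ ∷ u₂ ∷ u₁ ∷ []
    triangular : AllPairs (λ p q → p ≢ q × proj₁ (R p q) ≡ 0ℤ) Ps
    triangular =
      ((w₁w₂ , zero-entry w₁ w₂ πw₁ m₁ u₁≁w₂) ∷ (w₁w₃ , zero-entry w₁ w₃ πw₁ m₁ u₁≁w₃) ∷
       (w₁u₃ , zero-entry w₁ u₃ πw₁ m₁ u₁≁u₃) ∷ (w₁u₂ , zero-entry w₁ u₂ πw₁ m₁ u₁≁u₂) ∷
       (u₁w₁ ∘ sym , zero-entry w₁ u₁ πw₁ m₁ (loopless Γ u₁)) ∷ []) ∷
      ((w₂w₃ , zero-entry w₂ w₃ πw₂ m₃ u₂≁w₃) ∷ (w₂u₃ , zero-entry w₂ u₃ πw₂ m₃ u₂≁u₃) ∷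
       (u₂w₂ ∘ sym , zero-entry w₂ u₂ πw₂ m₃ (loopless Γ u₂)) ∷
       (u₁w₂ ∘ sym , zero-entry w₂ u₁ πw₂ m₃ (≁-sym u₁≁u₂)) ∷ []) ∷
      ((u₃w₃ ∘ sym , zero-entry w₃ u₃ πw₃ m₅ (loopless Γ u₃)) ∷
       (u₂w₃ ∘ sym , zero-entry w₃ u₂ πw₃ m₅ (≁-sym u₂≁u₃)) ∷
       (u₁w₃ ∘ sym , zero-entry w₃ u₁ πw₃ m₅ (≁-sym u₁≁u₃)) ∷ []) ∷
      ((u₂u₃ ∘ sym , zero-entry u₃ u₂ πu₃ m₆ (≁-sym u₂≁w₃)) ∷
       (u₁u₃ ∘ sym , zero-entry u₃ u₁ πu₃ m₆ (≁-sym u₁≁w₃)) ∷ []) ∷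
      ((u₁u₂ ∘ sym , zero-entry u₂ u₁ πu₂ m₄ (≁-sym u₁≁w₂)) ∷ []) ∷
      [] ∷ []
    diagonal : All (λ p → proj₁ (R p p) ≢ 0ℤ) Ps
    diagonal = pivot w₁ πw₁ m₁ e₁ ∷ pivot w₂ πw₂ m₃ e₂ ∷ pivot w₃ πw₃ m₅ e₃ ∷
               pivot u₃ πu₃ m₆ (∼-sym e₃) ∷ pivot u₂ πu₂ m₄ (∼-sym e₂) ∷ pivot u₁ πu₁ m₂ (∼-sym e₁) ∷ []
    rest : ∀ w → w ∈ Ps ⊎ R w ≗ basis w
    rest w with mem _≟_ w six
    ... | yes (here refl) = inj₁ (there (there (there (there (there (here refl))))))
    ... | yes (there (here refl)) = inj₁ (here refl)
    ... | yes (there (there (here refl))) = inj₁ (there (there (there (there (here refl)))))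
    ... | yes (there (there (there (here refl)))) = inj₁ (there (here refl))
    ... | yes (there (there (there (there (here refl))))) = inj₁ (there (there (there (here refl))))
    ... | yes (there (there (there (there (there (here refl)))))) = inj₁ (there (there (here refl)))
    ... | no w∉six = inj₂ λ i → trans (cong (λ m → R₀ m i) fixed)
                                      (cong (λ a → a i) (del-∈ Γ (∈-filter⁺ outside? (∈-allFin w) w∉six)))
      where
      off : ∀ {i} → i ∈ six → w ≢ i
      off i∈six refl = w∉six i∈six
      fixed : π w ≡ w
      fixed rewrite transpose-other u₃ w₃ (off m₅) (off m₆) | transpose-other u₂ w₂ (off m₃) (off m₄) =
        transpose-other u₁ w₁ (off m₁) (off m₂)

-- Counting edges

module Edges {n} (Γ : SignedGraph n) where

  open Adjacency Γ

  edge : Fin n → Fin n → ℕ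
  edge i j = nz Γ (adj Γ i j)

  edge-∼ : ∀ {i j} → i ∼ j → edge i j ≡ 1
  edge-∼ {i} {j} i∼j with adj Γ i j
  ... | + zero   = contradiction refl i∼j
  ... | + suc _  = refl
  ... | -[1+ _ ] = refl

  deg : Fin n → List (Fin n) → ℕ
  deg x S = Σℕ (map (edge x) S)

  -- Each edge is counted at whichever end comes first in the list. Unlike `edgeCount` this makes no
  -- reference to the numbering of the vertices, so it is invariant under permutation.
  edges : List (Fin n) → ℕ
  edges []      = 0
  edges (x ∷ S) = deg x S ℕ.+ edges S

  deg-↭ : ∀ x {S T} → S ↭ T → deg x S ≡ deg x T
  deg-↭ x S↭T = sum-↭ (map⁺ (edge x) S↭T)

  deg-++ : ∀ x S T → deg x (S ++ T) ≡ deg x S ℕ.+ deg x T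
  deg-++ x S T = trans (cong Σℕ (Listₚ.map-++ (edge x) S T)) (sum-++ (map (edge x) S) _)

  edges-↭ : ∀ {S T} → S ↭ T → edges S ≡ edges T
  edges-↭ Perm.refl = refl
  edges-↭ (prep x S↭T) = cong₂ ℕ._+_ (deg-↭ x S↭T) (edges-↭ S↭T)
  edges-↭ (Perm.swap {S} {T} x y S↭T) = begin
    (edge x y ℕ.+ deg x S) ℕ.+ (deg y S ℕ.+ edges S)
      ≡⟨ cong₂ (λ a b → (a ℕ.+ deg x S) ℕ.+ (deg y S ℕ.+ b)) (cong (nz Γ) (symm Γ x y)) (edges-↭ S↭T) ⟩
    (edge y x ℕ.+ deg x S) ℕ.+ (deg y S ℕ.+ edges T)
      ≡⟨ cong₂ (λ a b → (edge y x ℕ.+ a) ℕ.+ (b ℕ.+ edges T)) (deg-↭ x S↭T) (deg-↭ y S↭T) ⟩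
    (edge y x ℕ.+ deg x T) ℕ.+ (deg y T ℕ.+ edges T)
      ≡⟨ eq (edge y x) (deg x T) (deg y T) (edges T) ⟩
    (edge y x ℕ.+ deg y T) ℕ.+ (deg x T ℕ.+ edges T) ∎
    where
    open ≡-Reasoning
    eq : ∀ a b c d → (a ℕ.+ b) ℕ.+ (c ℕ.+ d) ≡ (a ℕ.+ c) ℕ.+ (b ℕ.+ d)
    eq = ℕ-Solver.solve-∀
  edges-↭ (Perm.trans S↭T T↭U) = trans (edges-↭ S↭T) (edges-↭ T↭U)

  edges-++ : ∀ S T → edges S ≤ edges (S ++ T)
  edges-++ []      T = z≤n
  edges-++ (x ∷ S) T =
    ℕₚ.+-mono-≤ (subst (deg x S ≤_) (sym (deg-++ x S T)) (ℕₚ.m≤m+n _ _)) (edges-++ S T)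

  edges-⊆ : ∀ {S T} → Unique S → S ⊆ T → edges S ≤ edges T
  edges-⊆ {S} uniq S⊆T with zs , perm ← unique-⊆⇒↭ uniq S⊆T =
    subst (edges S ≤_) (sym (edges-↭ perm)) (edges-++ S zs)

  neighbours≤deg : ∀ {x ns S} → Unique ns → ns ⊆ S → All (x ∼_) ns → length ns ≤ deg x S
  neighbours≤deg {x} {ns} uniq ns⊆S adjacent with zs , perm ← unique-⊆⇒↭ uniq ns⊆S =
    subst (length ns ≤_) (sym (trans (deg-↭ x perm) (deg-++ x ns zs)))
          (ℕₚ.m≤n⇒m≤n+o (deg x zs) (ℕₚ.≤-reflexive (sym (all-edges adjacent))))
    where
    all-edges : ∀ {ns} → All (x ∼_) ns → deg x ns ≡ length ns
    all-edges []         = refl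
    all-edges (x∼ ∷ x∼s) = cong₂ ℕ._+_ (edge-∼ x∼) (all-edges x∼s)

  -- `allFin n` is increasing, so the end that comes first is the smaller one.
  edges-allFin : edges (allFin n) ≡ edgeCount Γ
  edges-allFin = sym (sorted (allFin n) (tabulate⁺-< id))
    where
    below : Fin n → Fin n → ℕ
    below i j = if toℕ i ℕ.<ᵇ toℕ j then edge i j else 0
    below-< : ∀ {i j} → toℕ i < toℕ j → below i j ≡ edge i j
    below-< {i} {j} i<j with toℕ i ℕ.<ᵇ toℕ j | ℕₚ.<⇒<ᵇ i<j
    ... | true | _ = refl
    below-≮ : ∀ {i j} → ¬ toℕ i < toℕ j → below i j ≡ 0
    below-≮ {i} {j} i≮j with toℕ i ℕ.<ᵇ toℕ j | ℕₚ.<ᵇ⇒< (toℕ i) (toℕ j)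
    ... | true  | i<j = contradiction (i<j tt) i≮j
    ... | false | _   = refl
    sorted : ∀ L → AllPairs (λ i j → toℕ i < toℕ j) L →
             Σℕ (map (λ i → Σℕ (map (below i) L)) L) ≡ edges L
    sorted []      []           = refl
    sorted (x ∷ L) (x< ∷ order) = cong₂ ℕ._+_
      (cong₂ ℕ._+_ (below-≮ {x} {x} (ℕₚ.<-irrefl refl)) (cong Σℕ (Listₚ.map-cong-local (All.map below-< x<))))
      (trans (cong Σℕ (Listₚ.map-cong-local (All.map (λ {i} x<i →
               cong (ℕ._+ Σℕ (map (below i) L)) (below-≮ {i} {x} (ℕₚ.<⇒≯ x<i))) x<)))
             (sorted L order))

  -- The cyclomatic number of the subgraph induced on S is at least m
  -- whenever that subgraph is connected.
  record Surplus (m : ℕ) (S : List (Fin n)) : Set where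
    constructor surplus
    field
      {member} : Fin n
      member∈  : member ∈ S
      unique   : Unique S
      count    : length S ℕ.+ m ≤ suc (edges S)
  open Surplus public

  singleton : ∀ v → Surplus 0 (v ∷ [])
  singleton v = surplus (here refl) ([] ∷ []) ℕₚ.≤-refl

  -- The new vertex adds one to the length and at least k + 1 to the number of edges.
  extend : ∀ {m S w} k ns → Surplus m S → w ∉ S → Unique ns → ns ⊆ S → All (w ∼_) ns →
           suc k ≤ length ns → Surplus (k ℕ.+ m) (w ∷ S)
  extend {m} {S} {w} k ns sur w∉S uniq ns⊆S w∼ns k<ns = surplus (here refl)
    (All.tabulate (λ { x∈S refl → w∉S x∈S }) ∷ unique sur) (begin
      suc (length S) ℕ.+ (k ℕ.+ m)   ≡⟨ eq (length S) k m ⟩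
      suc k ℕ.+ (length S ℕ.+ m)     ≤⟨ ℕₚ.+-mono-≤ (ℕₚ.≤-trans k<ns (neighbours≤deg uniq ns⊆S w∼ns)) (count sur) ⟩
      deg w S ℕ.+ suc (edges S)      ≡⟨ ℕₚ.+-suc (deg w S) (edges S) ⟩
      suc (deg w S ℕ.+ edges S)      ∎)
    where
    open ℕₚ.≤-Reasoning
    eq : ∀ s k m → suc s ℕ.+ (k ℕ.+ m) ≡ suc k ℕ.+ (s ℕ.+ m)
    eq = ℕ-Solver.solve-∀

  crossing : ∀ {S s z} → s ∈ S → z ∉ S → Walk Γ s z →
             Σ (Fin n) λ w → Σ (Fin n) λ x → w ∉ S × x ∈ S × w ∼ x
  crossing s∈ z∉ here = contradiction s∈ z∉
  crossing {S} {s} s∈ z∉ (step {j = j} s∼j walk) with mem _≟_ j S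
  ... | yes j∈ = crossing j∈ z∉ walk
  ... | no j∉  = j , s , j∉ , s∈ , ∼-sym s∼j

  -- As long as `S` is not everything, some vertex outside is adjacent to it and can be added
  -- without loss of surplus. At the end a surplus of 3 means at least n + 2 edges, one too many.
  sparse : Bicyclic Γ → ∀ {S} → ¬ Surplus 3 S
  sparse (connected , edgeCount≡) {S} = grow n (ℕₚ.m≤n+m n (length S))
    where
    -- `fuel` bounds the number of vertices still missing from `S`.
    grow : ∀ fuel {S} → n ≤ length S ℕ.+ fuel → ¬ Surplus 3 S
    grow fuel {S} bound sur with all? (λ i → mem _≟_ i S)
    ... | yes all∈ = ℕₚ.<-irrefl refl (begin-strict
      suc n                     <⟨ ℕₚ.n<1+n _ ⟩
      2 ℕ.+ n                   ≡⟨ cong (2 ℕ.+_) (Listₚ.length-tabulate {n = n} id) ⟨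
      2 ℕ.+ length (allFin n)   ≤⟨ ℕₚ.+-monoʳ-≤ 2 (all-length (λ {x} _ → all∈ x)) ⟩
      2 ℕ.+ length S            ≡⟨ ℕₚ.+-comm 2 (length S) ⟩
      length S ℕ.+ 2            ≤⟨ ℕₚ.≤-pred (subst (_≤ suc (edges S)) (ℕₚ.+-suc (length S) 2) (count sur)) ⟩
      edges S                   ≤⟨ edges-⊆ (unique sur) (λ {x} _ → ∈-allFin x) ⟩
      edges (allFin n)          ≡⟨ edges-allFin ⟩
      edgeCount Γ               ≡⟨ edgeCount≡ ⟩
      suc n                     ∎)
      where
      open ℕₚ.≤-Reasoning
      all-length : allFin n ⊆ S → length (allFin n) ≤ length S
      all-length sub with zs , perm ← unique-⊆⇒↭ (Uniqueₚ.allFin⁺ n) sub =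
        subst (length (allFin n) ≤_)
              (trans (sym (Listₚ.length-++ (allFin n))) (sym (↭-length perm))) (ℕₚ.m≤m+n _ _)
    ... | no ¬all∈ with z , z∉ ← ¬∀⟶∃¬ n _ (λ i → mem _≟_ i S) ¬all∈
      with w , x , w∉ , x∈ , w∼x ← crossing (member∈ sur) z∉ (connected (member sur) z) = next fuel bound
      where
      larger : Surplus 3 (w ∷ S)
      larger = extend 0 (x ∷ []) sur w∉ ([] ∷ []) (λ { (here refl) → x∈ }) (w∼x ∷ []) ℕₚ.≤-refl
      next : ∀ fuel → n ≤ length S ℕ.+ fuel → ⊥
      next zero       bound = ℕₚ.<-irrefl refl (ℕₚ.≤-trans (unique⇒length≤ (unique larger))
                                (subst (n ≤_) (ℕₚ.+-identityʳ _) bound))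
      next (suc fuel) bound = grow fuel (subst (n ≤_) (ℕₚ.+-suc (length S) fuel) bound) larger

  -- `only` bounds the new set from above: this keeps the second cycle disjoint from the set built
  -- from the first, so that it can be added in turn.
  record Extension (m : ℕ) (zs S : List (Fin n)) : Set where
    constructor extension
    field
      {vertices′} : List (Fin n)
      surplus′ : Surplus m vertices′
      old      : S ⊆ vertices′
      new      : zs ⊆ vertices′
      only     : ∀ {x} → x ∈ vertices′ → x ∈ zs ⊎ x ∈ S
  open Extension public

  first : ∀ {m z zs S} → Extension m zs (z ∷ S) → Extension m (z ∷ zs) S
  first ext = extension (surplus′ ext) (old ext ∘ there)
    (λ { (here refl) → old ext (here refl) ; (there x∈) → new ext x∈ })
    (λ x∈ → [ inj₁ ∘ there , (λ { (here x≡z) → inj₁ (here x≡z) ; (there x∈S) → inj₂ x∈S }) ]′ (only ext x∈))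

  last-vertex : ∀ {m z S} → Surplus m (z ∷ S) → Extension m (z ∷ []) S
  last-vertex sur = extension sur there (λ { (here refl) → here refl })
    (λ { (here x≡z) → inj₁ (here x≡z) ; (there x∈) → inj₂ x∈ })

  fresh : ∀ {z : Fin n} {zs S} → Unique (z ∷ zs) → Disjoint (z ∷ zs) S → Disjoint zs (z ∷ S)
  fresh (z∉ ∷ _) disj (x∈zs , here refl) = All.lookup z∉ x∈zs refl
  fresh (z∉ ∷ _) disj (x∈zs , there x∈S) = disj (there x∈zs , x∈S)

  -- Adding an ear. Each vertex is joined to its predecessor `p`, which costs nothing; the last one
  -- is joined to `v` too, which gains one. That `p` differs from `v` makes these two distinct
  -- edges.
  close-path : ∀ {m S p v} z zs → Surplus m S → p ∈ S → v ∈ S → p ≢ v →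
    Unique (z ∷ zs) → Disjoint (z ∷ zs) S → Chain Γ (p ∷ z ∷ zs ++ v ∷ []) →
    Extension (1 ℕ.+ m) (z ∷ zs) S
  close-path {p = p} {v} z [] sur p∈ v∈ p≢v uniq disj (p∼z , z∼v , _) =
    last-vertex (extend 1 (p ∷ v ∷ []) sur (λ z∈ → disj (here refl , z∈)) ((p≢v ∷ []) ∷ [] ∷ [])
      (λ { (here refl) → p∈ ; (there (here refl)) → v∈ }) (∼-sym p∼z ∷ z∼v ∷ []) ℕₚ.≤-refl)
  close-path {p = p} z (z′ ∷ zs) sur p∈ v∈ p≢v uniq@(_ ∷ uniq′) disj (p∼z , chain) =
    first (close-path z′ zs
      (extend 0 (p ∷ []) sur z∉ ([] ∷ []) (λ { (here refl) → p∈ }) (∼-sym p∼z ∷ []) ℕₚ.≤-refl)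
      (here refl) (there v∈) (λ { refl → z∉ v∈ }) uniq′ (fresh uniq disj) chain)
    where
    z∉ = λ z∈ → disj (here refl , z∈)

  -- The edge from `c` to `y` is one further neighbour at the moment `c` is added.
  close-path-chord : ∀ {m S p v} z zs → Surplus m S → p ∈ S → v ∈ S → p ≢ v →
    Unique (z ∷ zs) → Disjoint (z ∷ zs) S → Chain Γ (p ∷ z ∷ zs ++ v ∷ []) →
    ∀ {c y} → c ∈ z ∷ zs → y ∈ S → y ≢ p → y ≢ v → c ∼ y →
    Extension (2 ℕ.+ m) (z ∷ zs) S
  close-path-chord {p = p} {v} z [] sur p∈ v∈ p≢v uniq disj
    (p∼z , z∼v , _) {y = y} (here refl) y∈ y≢p y≢v c∼y =
    last-vertex (extend 2 (y ∷ p ∷ v ∷ []) sur (λ z∈ → disj (here refl , z∈))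
      ((y≢p ∷ y≢v ∷ []) ∷ (p≢v ∷ []) ∷ [] ∷ [])
      (λ { (here refl) → y∈ ; (there (here refl)) → p∈ ; (there (there (here refl))) → v∈ })
      (c∼y ∷ ∼-sym p∼z ∷ z∼v ∷ []) ℕₚ.≤-refl)
  close-path-chord {p = p} z (z′ ∷ zs) sur p∈ v∈ p≢v uniq@(_ ∷ uniq′) disj
    (p∼z , chain) {y = y} (here refl) y∈ y≢p y≢v c∼y =
    first (close-path z′ zs
      (extend 1 (y ∷ p ∷ []) sur z∉ ((y≢p ∷ []) ∷ [] ∷ []) (λ { (here refl) → y∈ ; (there (here refl)) → p∈ })
        (c∼y ∷ ∼-sym p∼z ∷ []) ℕₚ.≤-refl)
      (here refl) (there v∈) (λ { refl → z∉ v∈ }) uniq′ (fresh uniq disj) chain)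
    where
    z∉ = λ z∈ → disj (here refl , z∈)
  close-path-chord {p = p} z (z′ ∷ zs) sur p∈ v∈ p≢v uniq@(_ ∷ uniq′) disj
    (p∼z , chain) (there c∈) y∈ y≢p y≢v c∼y =
    first (close-path-chord z′ zs
      (extend 0 (p ∷ []) sur z∉ ([] ∷ []) (λ { (here refl) → p∈ }) (∼-sym p∼z ∷ []) ℕₚ.≤-refl)
      (here refl) (there v∈) (λ { refl → z∉ v∈ }) uniq′ (fresh uniq disj) chain
      c∈ (there y∈) (λ { refl → z∉ y∈ }) y≢v c∼y)
    where
    z∉ = λ z∈ → disj (here refl , z∈)

  -- Here the ear begins and ends at the same vertex. Once `z` has been added its two ends differ
  -- and it is a path; hence at least two new vertices.
  close-cycle : ∀ {m S v} z z′ zs → Surplus m S → v ∈ S →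
    Unique (z ∷ z′ ∷ zs) → Disjoint (z ∷ z′ ∷ zs) S → Chain Γ (v ∷ z ∷ z′ ∷ zs ++ v ∷ []) →
    Extension (1 ℕ.+ m) (z ∷ z′ ∷ zs) S
  close-cycle {v = v} z z′ zs sur v∈ uniq@(_ ∷ uniq′) disj (v∼z , chain) =
    first (close-path z′ zs
      (extend 0 (v ∷ []) sur z∉ ([] ∷ []) (λ { (here refl) → v∈ }) (∼-sym v∼z ∷ []) ℕₚ.≤-refl)
      (here refl) (there v∈) (λ { refl → z∉ v∈ }) uniq′ (fresh uniq disj) chain)
    where
    z∉ = λ z∈ → disj (here refl , z∈)

  close-cycle-chord : ∀ {m S v} z z′ zs → Surplus m S → v ∈ S →
    Unique (z ∷ z′ ∷ zs) → Disjoint (z ∷ z′ ∷ zs) S → Chain Γ (v ∷ z ∷ z′ ∷ zs ++ v ∷ []) →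
    ∀ {c y} → c ∈ z ∷ z′ ∷ zs → y ∈ S → y ≢ v → c ∼ y →
    Extension (2 ℕ.+ m) (z ∷ z′ ∷ zs) S
  close-cycle-chord {v = v} z z′ zs sur v∈ uniq@(_ ∷ uniq′) disj (v∼z , chain)
    {y = y} (here refl) y∈ y≢v c∼y =
    first (close-path z′ zs
      (extend 1 (y ∷ v ∷ []) sur z∉ ((y≢v ∷ []) ∷ [] ∷ []) (λ { (here refl) → y∈ ; (there (here refl)) → v∈ })
        (c∼y ∷ ∼-sym v∼z ∷ []) ℕₚ.≤-refl)
      (here refl) (there v∈) (λ { refl → z∉ v∈ }) uniq′ (fresh uniq disj) chain)
    where
    z∉ = λ z∈ → disj (here refl , z∈)
  close-cycle-chord {v = v} z z′ zs sur v∈ uniq@(_ ∷ uniq′) disj (v∼z , chain) (there c∈) y∈ y≢v c∼y =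
    first (close-path-chord z′ zs
      (extend 0 (v ∷ []) sur z∉ ([] ∷ []) (λ { (here refl) → v∈ }) (∼-sym v∼z ∷ []) ℕₚ.≤-refl)
      (here refl) (there v∈) (λ { refl → z∉ v∈ }) uniq′ (fresh uniq disj) chain
      c∈ (there y∈) (λ { refl → z∉ y∈ }) y≢v c∼y)
    where
    z∉ = λ z∈ → disj (here refl , z∈)

-- Two cycles sharing a vertex

module Figure {n} (Γ : SignedGraph n) where

  open Adjacency Γ
  open Edges Γ

  chain-++ˡ : ∀ xs {m zs} → Chain Γ (xs ++ m ∷ zs) → Chain Γ (xs ++ m ∷ [])
  chain-++ˡ []           chain         = tt
  chain-++ˡ (x ∷ [])     (x∼m , chain) = x∼m , tt
  chain-++ˡ (x ∷ y ∷ xs) (x∼y , chain) = x∼y , chain-++ˡ (y ∷ xs) chain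

  chain-++ʳ : ∀ xs {m zs} → Chain Γ (xs ++ m ∷ zs) → Chain Γ (m ∷ zs)
  chain-++ʳ []           chain         = chain
  chain-++ʳ (x ∷ [])     (x∼m , chain) = chain
  chain-++ʳ (x ∷ y ∷ xs) (x∼y , chain) = chain-++ʳ (y ∷ xs) chain

  chain-++ : ∀ xs {m zs} → Chain Γ (xs ++ m ∷ []) → Chain Γ (m ∷ zs) → Chain Γ (xs ++ m ∷ zs)
  chain-++ []           chain       chain′ = chain′
  chain-++ (x ∷ [])     (x∼m , _)   chain′ = x∼m , chain′
  chain-++ (x ∷ y ∷ xs) (x∼y , chain) chain′ = x∼y , chain-++ (y ∷ xs) chain chain′

  record Loop (v : Fin n) (ys : List (Fin n)) : Set where
    field
      simple : Unique (v ∷ ys)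
      closes : Chain Γ (v ∷ ys ++ v ∷ [])
      long   : 2 ≤ length ys

  -- A `Cycle` may be listed from any of its vertices. Listing both cycles from their common vertex
  -- makes the remaining vertices two disjoint lists.
  rotate : (C : Cycle Γ) → ∀ {v} → v ∈ Cycle.vertices C →
           Σ (List (Fin n)) λ ys → Loop v ys × ys ⊆ Cycle.vertices C
  rotate C {v} v∈C with Cycle.closed C
  ... | x , xs , eq , chain = turn (subst (v ∈_) eq v∈C)
    where
    uniq : Unique (x ∷ xs)
    uniq = subst Unique eq (Cycle.distinct C)
    len : 3 ≤ length (x ∷ xs)
    len = subst (λ zs → 3 ≤ length zs) eq (Cycle.len≥3 C)
    turn : v ∈ x ∷ xs → Σ (List (Fin n)) λ ys → Loop v ys × ys ⊆ Cycle.vertices C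
    turn (here refl) = xs , record { simple = uniq ; closes = chain ; long = s≤s⁻¹ len } ,
      λ w∈ → subst (_ ∈_) (sym eq) (there w∈)
    turn (there v∈xs) with as , bs , eq′ ← ∈-∃++ v∈xs = bs ++ x ∷ as , record
      { simple = Unique-resp-↭ (setoid (Fin n)) (Perm.↭⇒↭ₛ split) uniq
      ; closes = subst (λ zs → Chain Γ (v ∷ zs)) (sym (Listₚ.++-assoc bs (x ∷ as) (v ∷ [])))
          (chain-++ (v ∷ bs) (chain-++ʳ (x ∷ as) chain′) (chain-++ˡ (x ∷ as) chain′))
      ; long   = s≤s⁻¹ (subst (3 ≤_) (↭-length split) len)
      } , λ w∈ → subst (_ ∈_) (sym eq) (∈-resp-↭ (↭-sym split) (there w∈))
      where
      split : x ∷ xs ↭ v ∷ bs ++ x ∷ as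
      split = subst (λ zs → x ∷ zs ↭ v ∷ bs ++ x ∷ as) (sym eq′) (Permₚ.++-comm (x ∷ as) (v ∷ bs))
      chain′ : Chain Γ ((x ∷ as) ++ v ∷ (bs ++ x ∷ []))
      chain′ = subst (λ zs → Chain Γ (x ∷ zs))
        (trans (cong (_++ x ∷ []) eq′) (Listₚ.++-assoc as (v ∷ bs) (x ∷ []))) chain

  -- The form in which a nullity greater than n - 6 is used, free of truncated subtraction.
  Vanishing : Set
  Vanishing = ∀ j → j ℕ.+ 6 ≤ n → D (charRow Γ) j ≡ 0ℤ

  record Infinity (v : Fin n) (ys zs : List (Fin n)) : Set where
    field
      left  : Loop v ys
      right : Loop v zs
      apart : Disjoint ys zs

  flip : ∀ {v ys zs} → Infinity v ys zs → Infinity v zs ys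
  flip fig = record { left = right ; right = left ; apart = λ (x∈ , x∈′) → apart (x∈′ , x∈) }
    where open Infinity fig

  ≁-stable : ∀ {i j} → ¬ (i ∼ j) → i ≁ j
  ≁-stable {i} {j} = decidable-stable (adj Γ i j ℤₚ.≟ 0ℤ)

  close-loop : ∀ {m S v zs} → Loop v zs → Surplus m S → v ∈ S → Disjoint zs S → Extension (1 ℕ.+ m) zs S
  close-loop {zs = []} loop sur v∈ disj = contradiction (Loop.long loop) λ ()
  close-loop {zs = _ ∷ []} loop sur v∈ disj = contradiction (Loop.long loop) λ { (s≤s ()) }
  close-loop {zs = z ∷ z′ ∷ zs} loop sur v∈ disj with _ ∷ uniq ← Loop.simple loop =
    close-cycle z z′ zs sur v∈ uniq disj (Loop.closes loop)

  close-loop-chord : ∀ {m S v zs} → Loop v zs → Surplus m S → v ∈ S → Disjoint zs S →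
    ∀ {c y} → c ∈ zs → y ∈ S → y ≢ v → c ∼ y → Extension (2 ℕ.+ m) zs S
  close-loop-chord {zs = []} loop sur v∈ disj = contradiction (Loop.long loop) λ ()
  close-loop-chord {zs = _ ∷ []} loop sur v∈ disj = contradiction (Loop.long loop) λ { (s≤s ()) }
  close-loop-chord {zs = z ∷ z′ ∷ zs} loop sur v∈ disj with _ ∷ uniq ← Loop.simple loop =
    close-cycle-chord z z′ zs sur v∈ uniq disj (Loop.closes loop)

  v∉loop : ∀ {v ys} → Loop v ys → v ∉ ys
  v∉loop loop v∈ with v∉ ∷ _ ← Loop.simple loop = All.lookup v∉ v∈ refl

  avoids-singleton : ∀ {v ys} → Loop v ys → Disjoint ys (v ∷ [])
  avoids-singleton loop (x∈ , here refl) = v∉loop loop x∈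

  avoids-extension : ∀ {m S v ys zs} → Infinity v ys zs → (ext : Extension m ys S) →
                     Disjoint zs S → Disjoint zs (vertices′ ext)
  avoids-extension fig ext disj (x∈zs , x∈) with only ext x∈
  ... | inj₁ x∈ys = Infinity.apart fig (x∈ys , x∈zs)
  ... | inj₂ x∈S  = disj (x∈zs , x∈S)

  neighbours : ∀ {v y y′ ys} → Loop v (y ∷ y′ ∷ ys) → Σ (Fin n) λ l → l ∈ y′ ∷ ys × l ∼ v
  neighbours {v} {y} {y′} {ys} loop = final y′ ys (proj₂ (proj₂ (Loop.closes loop)))
    where
    final : ∀ y ys → Chain Γ (y ∷ ys ++ v ∷ []) → Σ (Fin n) λ l → l ∈ y ∷ ys × l ∼ v
    final y []        (y∼v , _)   = y , here refl , y∼v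
    final y (y′ ∷ ys) (_ , chain) with l , l∈ , l∼v ← final y′ ys chain = l , there l∈ , l∼v

  spare-neighbour : ∀ {v ys} → Loop v ys → ∀ a → Σ (Fin n) λ c → c ∈ ys × c ≢ a × c ∼ v
  spare-neighbour {ys = []} loop a = contradiction (Loop.long loop) λ ()
  spare-neighbour {ys = _ ∷ []} loop a = contradiction (Loop.long loop) λ { (s≤s ()) }
  spare-neighbour {ys = y ∷ y′ ∷ ys} loop a with y ≟ a
  ... | no y≢a = y , here refl , y≢a , ∼-sym (proj₁ (Loop.closes loop))
  ... | yes refl with l , l∈ , l∼v ← neighbours loop | _ ∷ y∉ ∷ _ ← Loop.simple loop =
    l , there l∈ , (λ { refl → All.lookup y∉ l∈ refl }) , l∼v

  module _ (bicyclic : Bicyclic Γ) where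

    private
      variable
        v : Fin n
        ys zs : List (Fin n)

    -- The two cycles already give cyclomatic number two; an edge between them away from `v` would
    -- raise it to three.
    cross : Infinity v ys zs → ∀ {y z} → y ∈ ys → z ∈ zs → z ≁ y
    cross {v} fig y∈ z∈ = ≁-stable λ z∼y → sparse bicyclic (surplus′
      (close-loop-chord right (surplus′ ext) (old ext (here refl))
        (avoids-extension fig ext (avoids-singleton right))
        z∈ (new ext y∈) (λ { refl → v∉loop left y∈ }) z∼y))
      where
      open Infinity fig
      ext = close-loop left (singleton v) (here refl) (avoids-singleton left)

    core : (fig : Infinity v ys zs) → Σ (List (Fin n)) λ T → Surplus 2 T ×
           v ∈ T × ys ⊆ T × zs ⊆ T × T ⊆ v ∷ ys ++ zs
    core {v} {ys} {zs} fig = vertices′ ext₂ , surplus′ ext₂ , old ext₂ (old ext₁ (here refl)) ,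
      old ext₂ ∘ new ext₁ , new ext₂ , λ x∈ → [ there ∘ ∈-++⁺ʳ ys , inner ]′ (only ext₂ x∈)
      where
      open Infinity fig
      ext₁ = close-loop left (singleton v) (here refl) (avoids-singleton left)
      ext₂ = close-loop right (surplus′ ext₁) (old ext₁ (here refl))
               (avoids-extension fig ext₁ (avoids-singleton right))
      inner : ∀ {x} → x ∈ vertices′ ext₁ → x ∈ v ∷ ys ++ zs
      inner x∈ = [ there ∘ ∈-++⁺ˡ , (λ { (here refl) → here refl }) ]′ (only ext₁ x∈)

    -- A second neighbour in `T` would close a third cycle.
    leaf-like : ∀ {T u a} → Surplus 2 T → u ∉ T → a ∈ T → u ∼ a → ∀ {b} → b ∈ T → b ≢ a → u ≁ b
    leaf-like {a = a} sur u∉ a∈ u∼a {b} b∈ b≢a = ≁-stable λ u∼b → sparse bicyclic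
      (extend 1 (b ∷ a ∷ []) sur u∉ ((b≢a ∷ []) ∷ [] ∷ [])
        (λ { (here refl) → b∈ ; (there (here refl)) → a∈ }) (u∼b ∷ u∼a ∷ []) ℕₚ.≤-refl)

    -- The path v, y₁, y₂ is laid down first, so that the rest of the cycle is an ear from y₂ to v
    -- and the chord to y₁ is an additional edge. With the other cycle the surplus is three.
    no-chord : ∀ {y₁ y₂ y₃ y₄ ys} → Infinity v (y₁ ∷ y₂ ∷ y₃ ∷ y₄ ∷ ys) zs →
               ∀ {c} → c ∈ y₃ ∷ y₄ ∷ ys → c ≁ y₁
    no-chord {v} {zs} {y₁} {y₂} {y₃} {y₄} {ys} fig {c} c∈
      with (v≢y₁ ∷ v≢y₂ ∷ v≢ys) ∷ (y₁≢y₂ ∷ y₁≢ys) ∷ (y₂≢ys) ∷ uniq ← Loop.simple (Infinity.left fig)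
         | v∼y₁ , y₁∼y₂ , chain ← Loop.closes (Infinity.left fig)
      = ≁-stable chord-free
      where
      open Infinity fig
      S = y₂ ∷ y₁ ∷ v ∷ []
      path : Surplus 0 S
      path = extend 0 (y₁ ∷ [])
        (extend 0 (v ∷ []) (singleton v) (λ { (here refl) → v≢y₁ refl }) ([] ∷ []) id (∼-sym v∼y₁ ∷ []) ℕₚ.≤-refl)
        (λ { (here refl) → y₁≢y₂ refl ; (there (here refl)) → v≢y₂ refl })
        ([] ∷ []) (λ { (here refl) → here refl }) (∼-sym y₁∼y₂ ∷ []) ℕₚ.≤-refl
      ys-apart : Disjoint (y₃ ∷ y₄ ∷ ys) S
      ys-apart (x∈ , here refl)                 = All.lookup y₂≢ys x∈ refl
      ys-apart (x∈ , there (here refl))         = All.lookup y₁≢ys x∈ refl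
      ys-apart (x∈ , there (there (here refl))) = All.lookup v≢ys x∈ refl
      zs-apart : (ext : Extension 2 (y₃ ∷ y₄ ∷ ys) S) → Disjoint zs (vertices′ ext)
      zs-apart ext (x∈zs , x∈) with only ext x∈
      ... | inj₁ x∈ys                        = apart (there (there x∈ys) , x∈zs)
      ... | inj₂ (here refl)                 = apart (there (here refl) , x∈zs)
      ... | inj₂ (there (here refl))         = apart (here refl , x∈zs)
      ... | inj₂ (there (there (here refl))) = v∉loop right x∈zs
      chord-free : ¬ c ∼ y₁
      chord-free c∼y₁ = sparse bicyclic (surplus′
        (close-loop right (surplus′ ext) (old ext (there (there (here refl)))) (zs-apart ext)))
        where
        ext : Extension 2 (y₃ ∷ y₄ ∷ ys) S
        ext = close-path-chord y₃ (y₄ ∷ ys) path (here refl) (there (there (here refl))) (v≢y₂ ∘ sym)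
          uniq ys-apart chain c∈ (there (here refl)) y₁≢y₂ (v≢y₁ ∘ sym) c∼y₁

    -- The matching is uv, y₁y₂, z₁z₂: `u` is pendant, and without `v` the two cycle edges are not
    -- joined, by `cross`.
    leaf-at-centre : ∀ {T u} → Infinity v ys zs → v ∈ T → ys ⊆ T → zs ⊆ T → u ∉ T → u ∼ v →
                     (∀ {b} → b ∈ T → b ≢ v → u ≁ b) → ¬ Vanishing
    leaf-at-centre {ys = []}     fig _ _ _ _ _ _ = contradiction (Loop.long (Infinity.left fig)) λ ()
    leaf-at-centre {ys = _ ∷ []} fig _ _ _ _ _ _ = contradiction (Loop.long (Infinity.left fig)) λ { (s≤s ()) }
    leaf-at-centre {zs = []}     fig _ _ _ _ _ _ = contradiction (Loop.long (Infinity.right fig)) λ ()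
    leaf-at-centre {zs = _ ∷ []} fig _ _ _ _ _ _ = contradiction (Loop.long (Infinity.right fig)) λ { (s≤s ()) }
    leaf-at-centre {v} {y₁ ∷ y₂ ∷ ys} {z₁ ∷ z₂ ∷ zs} {T} {u} fig v∈ ys⊆ zs⊆ u∉ u∼v only-v =
      pendant-matching six u∼v y₁∼y₂ z₁∼z₂
        (away (ys⊆ y₁∈) v≢y₁) (away (ys⊆ y₂∈) v≢y₂) (away (zs⊆ z₁∈) v≢z₁) (away (zs⊆ z₂∈) v≢z₂)
        (≁-sym (cross fig y₁∈ z₁∈)) (≁-sym (cross fig y₁∈ z₂∈))
      where
      open Infinity fig
      y₁∈ = here refl
      y₂∈ = there (here refl)
      z₁∈ = here refl
      z₂∈ = there (here refl)
      v≢y : ∀ {y} → y ∈ y₁ ∷ y₂ ∷ ys → v ≢ y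
      v≢y y∈ refl = v∉loop left y∈
      v≢z : ∀ {z} → z ∈ z₁ ∷ z₂ ∷ zs → v ≢ z
      v≢z z∈ refl = v∉loop right z∈
      y≢z : ∀ {y z} → y ∈ y₁ ∷ y₂ ∷ ys → z ∈ z₁ ∷ z₂ ∷ zs → y ≢ z
      y≢z y∈ z∈ refl = apart (y∈ , z∈)
      u≢ : ∀ {b} → b ∈ T → u ≢ b
      u≢ b∈ refl = u∉ b∈
      v≢y₁ = v≢y y₁∈
      v≢y₂ = v≢y y₂∈
      v≢z₁ = v≢z z₁∈
      v≢z₂ = v≢z z₂∈
      away : ∀ {b} → b ∈ T → v ≢ b → u ≁ b
      away b∈ v≢b = only-v b∈ (v≢b ∘ sym)
      y₁∼y₂ = proj₁ (proj₂ (Loop.closes left))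
      z₁∼z₂ = proj₁ (proj₂ (Loop.closes right))
      y₁≢y₂ : y₁ ≢ y₂
      y₁≢y₂ with _ ∷ (y₁≢y₂ ∷ _) ∷ _ ← Loop.simple left = y₁≢y₂
      z₁≢z₂ : z₁ ≢ z₂
      z₁≢z₂ with _ ∷ (z₁≢z₂ ∷ _) ∷ _ ← Loop.simple right = z₁≢z₂
      six = (u≢ v∈ ∷ u≢ (ys⊆ y₁∈) ∷ u≢ (ys⊆ y₂∈) ∷ u≢ (zs⊆ z₁∈) ∷ u≢ (zs⊆ z₂∈) ∷ []) ∷
            (v≢y₁ ∷ v≢y₂ ∷ v≢z₁ ∷ v≢z₂ ∷ []) ∷
            (y₁≢y₂ ∷ y≢z y₁∈ z₁∈ ∷ y≢z y₁∈ z₂∈ ∷ []) ∷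
            (y≢z y₂∈ z₁∈ ∷ y≢z y₂∈ z₂∈ ∷ []) ∷ (z₁≢z₂ ∷ []) ∷ [] ∷ []

    -- The matching is ua, cv, z₁z₂. The centre has two neighbours on the cycle of `a`, so one of
    -- them, `c`, is still free; once `u` and `a` are gone it meets nothing else of the matching but
    -- `v`.
    leaf-on-cycle : ∀ {T u a} → Infinity v ys zs → v ∈ T → ys ⊆ T → zs ⊆ T → u ∉ T → a ∈ ys → u ∼ a →
                    (∀ {b} → b ∈ T → b ≢ a → u ≁ b) → ¬ Vanishing
    leaf-on-cycle {ys = []}     fig _ _ _ _ () _ _
    leaf-on-cycle {ys = _ ∷ []} fig _ _ _ _ _ _ _ = contradiction (Loop.long (Infinity.left fig)) λ { (s≤s ()) }
    leaf-on-cycle {zs = []}     fig _ _ _ _ _ _ _ = contradiction (Loop.long (Infinity.right fig)) λ ()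
    leaf-on-cycle {zs = _ ∷ []} fig _ _ _ _ _ _ _ = contradiction (Loop.long (Infinity.right fig)) λ { (s≤s ()) }
    leaf-on-cycle {v} {y₁ ∷ y₂ ∷ ys} {z₁ ∷ z₂ ∷ zs} {T} {u} {a} fig v∈ ys⊆ zs⊆ u∉ a∈ u∼a only-a
      with c , c∈ , c≢a , c∼v ← spare-neighbour (Infinity.left fig) a =
      pendant-matching
        ((u≢ (ys⊆ a∈) ∷ u≢ (ys⊆ c∈) ∷ u≢ v∈ ∷ u≢ (zs⊆ z₁∈) ∷ u≢ (zs⊆ z₂∈) ∷ []) ∷
         ((c≢a ∘ sym) ∷ (v≢y a∈ ∘ sym) ∷ y≢z a∈ z₁∈ ∷ y≢z a∈ z₂∈ ∷ []) ∷
         ((v≢y c∈ ∘ sym) ∷ y≢z c∈ z₁∈ ∷ y≢z c∈ z₂∈ ∷ []) ∷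
         (v≢z z₁∈ ∷ v≢z z₂∈ ∷ []) ∷ (z₁≢z₂ ∷ []) ∷ [] ∷ [])
        u∼a c∼v (proj₁ (proj₂ (Loop.closes right)))
        (only-a (ys⊆ c∈) c≢a) (only-a v∈ (v≢y a∈))
        (only-a (zs⊆ z₁∈) (y≢z a∈ z₁∈ ∘ sym)) (only-a (zs⊆ z₂∈) (y≢z a∈ z₂∈ ∘ sym))
        (≁-sym (cross fig c∈ z₁∈)) (≁-sym (cross fig c∈ z₂∈))
      where
      open Infinity fig
      z₁∈ = here refl
      z₂∈ = there (here refl)
      v≢y : ∀ {y} → y ∈ y₁ ∷ y₂ ∷ ys → v ≢ y
      v≢y y∈ refl = v∉loop left y∈
      v≢z : ∀ {z} → z ∈ z₁ ∷ z₂ ∷ zs → v ≢ z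
      v≢z z∈ refl = v∉loop right z∈
      y≢z : ∀ {y z} → y ∈ y₁ ∷ y₂ ∷ ys → z ∈ z₁ ∷ z₂ ∷ zs → y ≢ z
      y≢z y∈ z∈ refl = apart (y∈ , z∈)
      u≢ : ∀ {b} → b ∈ T → u ≢ b
      u≢ b∈ refl = u∉ b∈
      z₁≢z₂ : z₁ ≢ z₂
      z₁≢z₂ with _ ∷ (z₁≢z₂ ∷ _) ∷ _ ← Loop.simple right = z₁≢z₂

    -- The matching z₁z₂, y₁y₂, y₃y₄ avoids the centre and thus needs four further vertices on one
    -- cycle. After z₁z₂ is peeled off, y₁ is pendant by `no-chord`.
    long-cycle : Infinity v ys zs → 4 ≤ length ys → ¬ Vanishing
    long-cycle {ys = _ ∷ []}         fig (s≤s ())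
    long-cycle {ys = _ ∷ _ ∷ []}     fig (s≤s (s≤s ()))
    long-cycle {ys = _ ∷ _ ∷ _ ∷ []} fig (s≤s (s≤s (s≤s ())))
    long-cycle {zs = []}     fig _ = contradiction (Loop.long (Infinity.right fig)) λ ()
    long-cycle {zs = _ ∷ []} fig _ = contradiction (Loop.long (Infinity.right fig)) λ { (s≤s ()) }
    long-cycle {v} {y₁ ∷ y₂ ∷ y₃ ∷ y₄ ∷ ys} {z₁ ∷ z₂ ∷ zs} fig _
      with _ ∷ (y₁≢y₂ ∷ y₁≢y₃ ∷ y₁≢y₄ ∷ _) ∷ (y₂≢y₃ ∷ y₂≢y₄ ∷ _) ∷ (y₃≢y₄ ∷ _) ∷ _ ← Loop.simple (Infinity.left fig)
         | _ ∷ (z₁≢z₂ ∷ _) ∷ _ ← Loop.simple (Infinity.right fig)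
         | _ , y₁∼y₂ , _ , y₃∼y₄ , _ ← Loop.closes (Infinity.left fig) =
      pendant-matching
        ((z₁≢z₂ ∷ z≢y z₁∈ y₁∈ ∷ z≢y z₁∈ y₂∈ ∷ z≢y z₁∈ y₃∈ ∷ z≢y z₁∈ y₄∈ ∷ []) ∷
         (z≢y z₂∈ y₁∈ ∷ z≢y z₂∈ y₂∈ ∷ z≢y z₂∈ y₃∈ ∷ z≢y z₂∈ y₄∈ ∷ []) ∷
         (y₁≢y₂ ∷ y₁≢y₃ ∷ y₁≢y₄ ∷ []) ∷ (y₂≢y₃ ∷ y₂≢y₄ ∷ []) ∷ (y₃≢y₄ ∷ []) ∷ [] ∷ [])
        (proj₁ (proj₂ (Loop.closes right))) y₁∼y₂ y₃∼y₄
        (cross fig y₁∈ z₁∈) (cross fig y₂∈ z₁∈) (cross fig y₃∈ z₁∈) (cross fig y₄∈ z₁∈)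
        (≁-sym (no-chord fig (here refl))) (≁-sym (no-chord fig (there (here refl))))
      where
      open Infinity fig
      z₁∈ = here refl
      z₂∈ = there (here refl)
      y₁∈ = here refl
      y₂∈ = there (here refl)
      y₃∈ = there (there (here refl))
      y₄∈ = there (there (there (here refl)))
      z≢y : ∀ {y z} → z ∈ z₁ ∷ z₂ ∷ zs → y ∈ y₁ ∷ y₂ ∷ y₃ ∷ y₄ ∷ ys → z ≢ y
      z≢y z∈ y∈ refl = apart (y∈ , z∈)

    infinity-rank : Infinity v ys zs → 8 ≤ n → ¬ Vanishing
    infinity-rank {v} {ys} {zs} fig 8≤n vanishing
      with T , sur , v∈ , ys⊆ , zs⊆ , T⊆ ← core fig
      with all? (λ i → mem _≟_ i T)
    ... | no ¬all∈
      with w , w∉ ← ¬∀⟶∃¬ n _ (λ i → mem _≟_ i T) ¬all∈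
      with u , a , u∉ , a∈ , u∼a ← crossing v∈ w∉ (proj₁ bicyclic v w) = attached (T⊆ a∈)
      where
      alone = leaf-like sur u∉ a∈ u∼a
      attached : a ∈ v ∷ ys ++ zs → ⊥
      attached (here refl) = leaf-at-centre fig v∈ ys⊆ zs⊆ u∉ u∼a alone vanishing
      attached (there a∈) with ∈-++⁻ ys a∈
      ... | inj₁ a∈ys = leaf-on-cycle fig v∈ ys⊆ zs⊆ u∉ a∈ys u∼a alone vanishing
      ... | inj₂ a∈zs = leaf-on-cycle (flip fig) v∈ zs⊆ ys⊆ u∉ a∈zs u∼a alone vanishing
    ... | yes all∈ with 4 ℕ.≤? length ys | 4 ℕ.≤? length zs
    ...   | yes 4≤ys | _        = long-cycle fig 4≤ys vanishing
    ...   | no _     | yes 4≤zs = long-cycle (flip fig) 4≤zs vanishing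
    -- Without trees and with both cycles of length at most four there are at most 1 + 3 + 3
    -- vertices, which `8 ≤ n` excludes.
    ...   | no ys<4  | no zs<4  = ℕₚ.<-irrefl refl (begin-strict
      7                                 <⟨ 8≤n ⟩
      n                                 ≡⟨ Listₚ.length-tabulate {n = n} id ⟨
      length (allFin n)                 ≤⟨ cover ⟩
      length (v ∷ ys ++ zs)             ≡⟨ cong suc (Listₚ.length-++ ys) ⟩
      suc (length ys ℕ.+ length zs)     ≤⟨ s≤s (ℕₚ.+-mono-≤ (s≤s⁻¹ (ℕₚ.≰⇒> ys<4)) (s≤s⁻¹ (ℕₚ.≰⇒> zs<4))) ⟩
      7                                 ∎)
      where
      open ℕₚ.≤-Reasoning
      cover : length (allFin n) ≤ length (v ∷ ys ++ zs)
      cover with zs′ , perm ← unique-⊆⇒↭ (Uniqueₚ.allFin⁺ n) (λ {x} _ → T⊆ (all∈ x)) =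
        subst (length (allFin n) ≤_)
              (trans (sym (Listₚ.length-++ (allFin n))) (sym (↭-length perm))) (ℕₚ.m≤m+n _ _)

η-upper : ∀ {n} (Γ : SignedGraph n) → InBpp Γ → 8 ≤ n → η Γ ≤ n ∸ 6
η-upper {n} Γ (bicyclic , C₁ , C₂ , v , v∈C₁ , v∈C₂ , meet) 8≤n
  with ys , loop₁ , ys⊆ ← Figure.rotate Γ C₁ v∈C₁ | zs , loop₂ , zs⊆ ← Figure.rotate Γ C₂ v∈C₂
  with η Γ ℕ.≤? n ∸ 6
... | yes η≤ = η≤
... | no η≰ = contradiction vanishing (infinity-rank bicyclic fig 8≤n)
  where
  open Figure Γ
  fig : Infinity v ys zs
  fig = record { left = loop₁ ; right = loop₂ ; apart = λ (w∈ys , w∈zs) →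
    v∉loop loop₁ (subst (_∈ ys) (meet _ (ys⊆ w∈ys) (zs⊆ w∈zs)) w∈ys) }
  vanishing : Vanishing
  vanishing j j+6≤n = trans (sym (charPoly-D Γ j)) (coef-mult0 (charPoly Γ) (begin-strict
    j                  ≡⟨ ℕₚ.m+n∸n≡m j 6 ⟨
    j ℕ.+ 6 ∸ 6      ≤⟨ ℕₚ.∸-monoˡ-≤ 6 j+6≤n ⟩
    n ∸ 6            <⟨ ℕₚ.≰⇒> η≰ ⟩
    η Γ                ∎))
    where open ℕₚ.≤-Reasoning

-- Attaching leaves

pendantRow : ∀ {n} → Fin n → Row (suc n)
pendantRow g zero    = 0ℤ , 1ℤ
pendantRow g (suc w) = - δ g w , 0ℤ

-- Stated for matrices instead of graphs because it is also applied after the row of the hub has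
-- become a unit row.
module Pendant {n} (R : Fin (suc n) → Row (suc n)) (g : Fin n) (R₀ : R zero ≗ pendantRow g) where

  minor : Fin n → Row n
  minor i = R (suc i) ∘ suc

  -- Kept apart from the condition on the column, which fails when the row of `g` itself is a unit
  -- row, as it is for the graph without its hub.
  D-pendantRow : ∀ j → D R j ≡ ((0ℤ , 1ℤ) ▷ D minor) j + - D (R [ zero ≔ basis (suc g) ]) j
  D-pendantRow j = begin
    D R j
      ≡⟨ D-expand R zero (R zero) j ⟩
    (R zero zero ▷ D (R [ zero ≔ basis zero ])) j + (∑ λ w → (R zero (suc w) ▷ E w) j)
      ≡⟨ cong₂ _+_ head tail ⟩
    ((0ℤ , 1ℤ) ▷ D minor) j + - E g j ∎
    where
    open ≡-Reasoning
    E : Fin n → Series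
    E w = D (R [ zero ≔ basis (suc w) ])
    head : (R zero zero ▷ D (R [ zero ≔ basis zero ])) j ≡ ((0ℤ , 1ℤ) ▷ D minor) j
    head = trans (cong (λ p → (p ▷ D (R [ zero ≔ basis zero ])) j) (R₀ zero))
                 (▷-cong (0ℤ , 1ℤ) (λ i → trans (D-minor R zero i) (ℤₚ.*-identityˡ _)) j)
    term : ∀ w → (R zero (suc w) ▷ E w) j ≡ - δ g w * E w j
    term w = trans (cong (λ p → (p ▷ E w) j) (R₀ (suc w))) (▷-const (- δ g w) (E w) j)
    tail : (∑ λ w → (R zero (suc w) ▷ E w) j) ≡ - E g j
    tail = begin
      (∑ λ w → (R zero (suc w) ▷ E w) j) ≡⟨ sum-cong-≗ term ⟩
      (∑ λ w → - δ g w * E w j)          ≡⟨ ∑-single g (λ w w≢g → cong (λ d → - d * E w j) (δ-off (w≢g ∘ sym))) ⟩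
      - δ g g * E g j                    ≡⟨ cong (λ d → - d * E g j) (δ-diag g) ⟩
      -1ℤ * E g j                        ≡⟨ ℤₚ.-1*i≡-i _ ⟩
      - E g j                            ∎

  -- Only row suc g meets column zero, so it may be replaced by its entry there.
  D-pendantColumn : (∀ i → R (suc i) zero ≡ (- δ g i , 0ℤ)) → ∀ j →
                    D (R [ zero ≔ basis (suc g) ]) j ≡ D (minor [ g ≔ basis g ]) j
  D-pendantColumn column j = begin
    D R₁ j
      ≡⟨ D-cong R₁ (λ i w → cong (λ a → a w) (sym (VFₚ.updateAt-id-local (suc g) R₁ refl i))) j ⟩
    D (R₁ [ suc g ≔ R (suc g) ]) j
      ≡⟨ D-expand R₁ (suc g) (R (suc g)) j ⟩
    (R (suc g) zero ▷ D (R₁ [ suc g ≔ basis zero ])) j +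
      (∑ λ w → (R (suc g) (suc w) ▷ D (R₁ [ suc g ≔ basis (suc w) ])) j)
      ≡⟨ cong₂ _+_ head (∑-zero λ w →
           ▷-zeroʳ (R (suc g) (suc w)) (D-column (R₁ [ suc g ≔ basis (suc w) ]) (empty w)) j) ⟩
    - D (R₁ [ suc g ≔ basis zero ]) j + 0ℤ
      ≡⟨ ℤₚ.+-identityʳ _ ⟩
    - D (R₁ [ suc g ≔ basis zero ]) j
      ≡⟨ cong -_ (D-swap R {zero} {suc g} (λ ()) (basis (suc g)) (basis zero) j) ⟩
    - - D (R [ zero ≔ basis zero ] [ suc g ≔ basis (suc g) ]) j
      ≡⟨ ℤₚ.neg-involutive _ ⟩
    D (R [ suc g ≔ basis (suc g) ] [ zero ≔ basis zero ]) j
      ≡⟨ D-minor (R [ suc g ≔ basis (suc g) ]) zero j ⟩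
    1ℤ * D (λ i → (R [ suc g ≔ basis (suc g) ]) (suc i) ∘ suc) j
      ≡⟨ ℤₚ.*-identityˡ _ ⟩
    D (λ i → (R [ suc g ≔ basis (suc g) ]) (suc i) ∘ suc) j
      ≡⟨ D-cong _ block j ⟩
    D (minor [ g ≔ basis g ]) j ∎
    where
    open ≡-Reasoning
    R₁ = R [ zero ≔ basis (suc g) ]
    head : (R (suc g) zero ▷ D (R₁ [ suc g ≔ basis zero ])) j ≡ - D (R₁ [ suc g ≔ basis zero ]) j
    head = trans (cong (λ p → (p ▷ D (R₁ [ suc g ≔ basis zero ])) j)
                       (trans (column g) (cong (λ d → - d , 0ℤ) (δ-diag g))))
                 (▷-neg _ j)
    empty : ∀ w i → (R₁ [ suc g ≔ basis (suc w) ]) i zero ≡ (0ℤ , 0ℤ)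
    empty w zero = refl
    empty w (suc i) with i ≟ g
    ... | yes refl = cong (λ a → a zero) (≔-at R₁ (suc g) (basis (suc w)))
    ... | no i≢g = trans (cong (λ a → a zero) (≔-off R₁ (suc g) (basis (suc w)) (i≢g ∘ suc-injective)))
                   (trans (column i) (cong (λ d → - d , 0ℤ) (δ-off (i≢g ∘ sym))))
    block : (λ i → (R [ suc g ≔ basis (suc g) ]) (suc i) ∘ suc) ≋ minor [ g ≔ basis g ]
    block i w with i ≟ g
    ... | yes refl rewrite ≔-at R (suc g) (basis (suc g)) | ≔-at minor g (basis g) = refl
    ... | no i≢g rewrite ≔-off R (suc g) (basis (suc g)) (i≢g ∘ suc-injective)
                       | ≔-off minor g (basis g) i≢g = refl

  D-pendant : (∀ i → R (suc i) zero ≡ (- δ g i , 0ℤ)) → ∀ j →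
              D R j ≡ ((0ℤ , 1ℤ) ▷ D minor) j + - D (minor [ g ≔ basis g ]) j
  D-pendant column j = trans (D-pendantRow j)
    (cong (λ x → ((0ℤ , 1ℤ) ▷ D minor) j + - x) (D-pendantColumn column j))

leafAdj : ∀ {n} → (Fin n → Fin n → ℤ) → Fin n → Fin (suc n) → Fin (suc n) → ℤ
leafAdj A h zero    zero    = 0ℤ
leafAdj A h zero    (suc j) = δ h j
leafAdj A h (suc i) zero    = δ h i
leafAdj A h (suc i) (suc j) = A i j

addLeaf : ∀ {n} → SignedGraph n → Fin n → SignedGraph (suc n)
addLeaf Γ h = record { adj = leafAdj (adj Γ) h ; entries = en ; symm = sy ; loopless = lo }
  where
  δ-entries : ∀ {n} (i j : Fin n) → δ i j ≡ 0ℤ ⊎ δ i j ≡ 1ℤ ⊎ δ i j ≡ -1ℤ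
  δ-entries i j with i ≟ j
  ... | yes refl = inj₂ (inj₁ (δ-diag i))
  ... | no i≢j   = inj₁ (δ-off i≢j)
  en : ∀ i j → leafAdj (adj Γ) h i j ≡ 0ℤ ⊎ leafAdj (adj Γ) h i j ≡ 1ℤ ⊎ leafAdj (adj Γ) h i j ≡ -1ℤ
  en zero    zero    = inj₁ refl
  en zero    (suc j) = δ-entries h j
  en (suc i) zero    = δ-entries h i
  en (suc i) (suc j) = entries Γ i j
  sy : ∀ i j → leafAdj (adj Γ) h i j ≡ leafAdj (adj Γ) h j i
  sy zero    zero    = refl
  sy zero    (suc j) = refl
  sy (suc i) zero    = refl
  sy (suc i) (suc j) = symm Γ i j
  lo : ∀ i → leafAdj (adj Γ) h i i ≡ 0ℤ
  lo zero    = refl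
  lo (suc i) = loopless Γ i

φ : ∀ {n} → SignedGraph n → Series
φ Γ = D (charRow Γ)

-- The characteristic polynomial of the graph with h deleted.
φ∖ : ∀ {n} → SignedGraph n → Fin n → Series
φ∖ Γ h = D (charRow Γ [ h ≔ basis h ])

addLeaf-row : ∀ {n} (Γ : SignedGraph n) h → charRow (addLeaf Γ h) zero ≗ pendantRow h
addLeaf-row Γ h zero    = refl
addLeaf-row Γ h (suc w) = refl

φ-leaf : ∀ {n} (Γ : SignedGraph n) h j → φ (addLeaf Γ h) j ≡ ((0ℤ , 1ℤ) ▷ φ Γ) j + - φ∖ Γ h j
φ-leaf Γ h = Pendant.D-pendant (charRow (addLeaf Γ h)) h (addLeaf-row Γ h) (λ _ → refl)

block-basis : ∀ {n} (Γ : SignedGraph n) g h →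
  (λ i → (charRow (addLeaf Γ g) [ suc h ≔ basis (suc h) ]) (suc i) ∘ suc) ≋ charRow Γ [ h ≔ basis h ]
block-basis Γ g h i w with i ≟ h
... | yes refl rewrite ≔-at (charRow (addLeaf Γ g)) (suc h) (basis (suc h)) | ≔-at (charRow Γ) h (basis h) = refl
... | no i≢h rewrite ≔-off (charRow (addLeaf Γ g)) (suc h) (basis (suc h)) (i≢h ∘ suc-injective)
                   | ≔-off (charRow Γ) h (basis h) i≢h = refl

-- Without the hub the leaf is isolated and contributes a factor x. The other term of the expansion
-- has the unit row of the hub twice.
φ∖-leaf : ∀ {n} (Γ : SignedGraph n) h j → φ∖ (addLeaf Γ h) (suc h) j ≡ ((0ℤ , 1ℤ) ▷ φ∖ Γ h) j
φ∖-leaf Γ h j = begin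
  D R j
    ≡⟨ Pendant.D-pendantRow R h (addLeaf-row Γ h) j ⟩
  ((0ℤ , 1ℤ) ▷ D (λ i → R (suc i) ∘ suc)) j + - D (R [ zero ≔ basis (suc h) ]) j
    ≡⟨ cong₂ (λ x y → x + - y) (▷-cong (0ℤ , 1ℤ) (D-cong _ (block-basis Γ h h)) j)
         (D-alternating (R [ zero ≔ basis (suc h) ]) {zero} {suc h} (λ ())
           (λ w → cong (λ a → a w) (sym (≔-at (charRow (addLeaf Γ h)) (suc h) (basis (suc h))))) j) ⟩
  ((0ℤ , 1ℤ) ▷ φ∖ Γ h) j + 0ℤ
    ≡⟨ ℤₚ.+-identityʳ _ ⟩
  ((0ℤ , 1ℤ) ▷ φ∖ Γ h) j ∎
  where
  open ≡-Reasoning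
  R = charRow (addLeaf Γ h) [ suc h ≔ basis (suc h) ]

-- Without the hub the two new vertices form a separate edge, of determinant -1. So twigs change the
-- number of vertices by two and keep the graph without its hub nonsingular.
φ∖-twig : ∀ {n} (Γ : SignedGraph n) h →
          φ∖ (addLeaf (addLeaf Γ h) zero) (suc (suc h)) 0 ≡ - φ∖ Γ h 0
φ∖-twig Γ h = begin
  D R 0
    ≡⟨ Pendant.D-pendant R zero (addLeaf-row Γ′ zero) column 0 ⟩
  0ℤ + - D ((λ i → R (suc i) ∘ suc) [ zero ≔ basis zero ]) 0
    ≡⟨ ℤₚ.+-identityˡ _ ⟩
  - D ((λ i → R (suc i) ∘ suc) [ zero ≔ basis zero ]) 0
    ≡⟨ cong -_ (trans (D-minor (λ i → R (suc i) ∘ suc) zero 0) (ℤₚ.*-identityˡ _)) ⟩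
  - D (λ i w → R (suc (suc i)) (suc (suc w))) 0
    ≡⟨ cong -_ (D-cong _ (λ i w → trans (block-basis Γ′ zero (suc h) (suc i) (suc w))
                                     (block-basis Γ h h i w)) 0) ⟩
  - φ∖ Γ h 0 ∎
  where
  open ≡-Reasoning
  Γ′ = addLeaf Γ h
  R = charRow (addLeaf Γ′ zero) [ suc (suc h) ≔ basis (suc (suc h)) ]
  column : ∀ i → R (suc i) zero ≡ (- δ zero i , 0ℤ)
  column zero = refl
  column (suc i) with i ≟ h
  ... | yes refl rewrite ≔-at (charRow (addLeaf Γ′ zero)) (suc (suc h)) (basis (suc (suc h))) = refl
  ... | no i≢h rewrite ≔-off (charRow (addLeaf Γ′ zero)) (suc (suc h)) (basis (suc (suc h)))
                         (i≢h ∘ suc-injective ∘ suc-injective) = refl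

lift-chain : ∀ {n} (Γ : SignedGraph n) h xs → Chain Γ xs → Chain (addLeaf Γ h) (map suc xs)
lift-chain Γ h []           chain         = tt
lift-chain Γ h (x ∷ [])     chain         = tt
lift-chain Γ h (x ∷ y ∷ xs) (x∼y , chain) = x∼y , lift-chain Γ h (y ∷ xs) chain

lift-sign : ∀ {n} (Γ : SignedGraph n) h xs → chainSign (addLeaf Γ h) (map suc xs) ≡ chainSign Γ xs
lift-sign Γ h []           = refl
lift-sign Γ h (x ∷ [])     = refl
lift-sign Γ h (x ∷ y ∷ xs) = cong (_*_ (adj Γ x y)) (lift-sign Γ h (y ∷ xs))

module _ {n} (Γ : SignedGraph n) (h : Fin n) where

  private
    Γ′ = addLeaf Γ h

  lift-cycle : Cycle Γ → Cycle Γ′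
  lift-cycle C = record
    { vertices = map suc (Cycle.vertices C)
    ; distinct = Uniqueₚ.map⁺ suc-injective (Cycle.distinct C)
    ; len≥3    = subst (3 ≤_) (sym (Listₚ.length-map suc (Cycle.vertices C))) (Cycle.len≥3 C)
    ; closed   = suc x , map suc xs , cong (map suc) eq ,
                 subst (Chain Γ′) (cong (suc x ∷_) (Listₚ.map-++ suc xs (x ∷ [])))
                       (lift-chain Γ h (x ∷ xs ++ x ∷ []) chain)
    }
    where
    x = proj₁ (Cycle.closed C)
    xs = proj₁ (proj₂ (Cycle.closed C))
    eq = proj₁ (proj₂ (proj₂ (Cycle.closed C)))
    chain = proj₂ (proj₂ (proj₂ (Cycle.closed C)))

  lift-cycleSign : ∀ C → cycleSign Γ′ (lift-cycle C) ≡ cycleSign Γ C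
  lift-cycleSign C = trans (cong (λ zs → chainSign Γ′ (suc x ∷ zs)) (sym (Listₚ.map-++ suc xs (x ∷ []))))
                           (lift-sign Γ h (x ∷ xs ++ x ∷ []))
    where
    x = proj₁ (Cycle.closed C)
    xs = proj₁ (proj₂ (Cycle.closed C))

  unbalanced-leaf : Unbalanced Γ → Unbalanced Γ′
  unbalanced-leaf unbalanced balanced =
    unbalanced λ C → trans (sym (lift-cycleSign C)) (balanced (lift-cycle C))

  connected-leaf : Connected Γ → Connected Γ′
  connected-leaf connected = walk
    where
    lift-walk : ∀ {i j} → Walk Γ i j → Walk Γ′ (suc i) (suc j)
    lift-walk here         = here
    lift-walk (step i∼k w) = step i∼k (lift-walk w)
    snoc : ∀ {i j k} → Walk Γ′ i j → Adj Γ′ j k → Walk Γ′ i k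
    snoc here         j∼k = step j∼k here
    snoc (step i∼l w) j∼k = step i∼l (snoc w j∼k)
    edge : δ h h ≢ 0ℤ
    edge eq with () ← trans (sym (δ-diag h)) eq
    walk : Connected Γ′
    walk zero    zero    = here
    walk zero    (suc j) = step edge (lift-walk (connected h j))
    walk (suc i) zero    = snoc (lift-walk (connected i h)) edge
    walk (suc i) (suc j) = lift-walk (connected i j)

  -- The leaf has the smallest number, so its edge is counted in row zero and the other rows keep
  -- their sums.
  edgeCount-leaf : edgeCount Γ′ ≡ suc (edgeCount Γ)
  edgeCount-leaf = cong₂ ℕ._+_ leaf-row (trans (cong Σℕ (Listₚ.map-tabulate suc rows′))
    (trans (cong Σℕ (Listₚ.tabulate-cong old-row)) (sym (cong Σℕ (Listₚ.map-tabulate id rows)))))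
    where
    row : Fin n → Fin n → ℕ
    row i j = if toℕ i ℕ.<ᵇ toℕ j then nz Γ (adj Γ i j) else 0
    rows : Fin n → ℕ
    rows i = Σℕ (map (row i) (allFin n))
    row′ : Fin (suc n) → Fin (suc n) → ℕ
    row′ i j = if toℕ i ℕ.<ᵇ toℕ j then nz Γ′ (adj Γ′ i j) else 0
    rows′ : Fin (suc n) → ℕ
    rows′ i = Σℕ (map (row′ i) (allFin (suc n)))
    -- `nz` carries the graph as a module parameter, so its two instances are compared by cases.
    nz-irrelevant : ∀ z → nz Γ′ z ≡ nz Γ z
    nz-irrelevant (+ zero)  = refl
    nz-irrelevant (+ suc _) = refl
    nz-irrelevant -[1+ _ ]  = refl
    ones : ∀ {k} (g : Fin k) → Σℕ (List.tabulate (λ j → nz Γ′ (δ g j))) ≡ 1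
    ones {suc k} zero    = cong suc (zeros k)
      where
      zeros : ∀ k → Σℕ (List.tabulate {n = k} (λ _ → 0)) ≡ 0
      zeros zero    = refl
      zeros (suc k) = zeros k
    ones {suc k} (suc g) = ones g
    leaf-row : rows′ zero ≡ 1
    leaf-row = trans (cong Σℕ (Listₚ.map-tabulate suc (row′ zero))) (ones h)
    old-row : ∀ i → rows′ (suc i) ≡ rows i
    old-row i = trans (cong Σℕ (Listₚ.map-tabulate suc (row′ (suc i))))
      (trans (cong Σℕ (Listₚ.tabulate-cong λ j →
                cong (λ m → if toℕ i ℕ.<ᵇ toℕ j then m else 0) (nz-irrelevant (adj Γ i j))))
             (sym (cong Σℕ (Listₚ.map-tabulate id (row i)))))

  inBpp-leaf : InBpp Γ → InBpp Γ′
  inBpp-leaf ((connected , count) , C₁ , C₂ , v , v∈C₁ , v∈C₂ , meet) =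
    (connected-leaf connected , trans edgeCount-leaf (cong suc count)) ,
    lift-cycle C₁ , lift-cycle C₂ , suc v , ∈-map⁺ suc v∈C₁ , ∈-map⁺ suc v∈C₂ , meet′
    where
    meet′ : ∀ w → w ∈ map suc (Cycle.vertices C₁) → w ∈ map suc (Cycle.vertices C₂) → w ≡ suc v
    meet′ w w∈₁ w∈₂ with x , x∈₁ , refl ← ∈-map⁻ suc w∈₁ | y , y∈₂ , refl ← ∈-map⁻ suc w∈₂ =
      cong suc (meet x x∈₁ y∈₂)

-- Starting graphs and the realization of every nullity

-- Two negative triangles 0 1 2 and 0 3 4.
bowtie : SignedGraph 5
bowtie = record
  { adj      = a
  ; entries  = toWitness {a? = all? λ i → all? λ j →
      (a i j ℤₚ.≟ 0ℤ) ⊎-dec ((a i j ℤₚ.≟ 1ℤ) ⊎-dec (a i j ℤₚ.≟ -1ℤ))} tt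
  ; symm     = toWitness {a? = all? λ i → all? λ j → a i j ℤₚ.≟ a j i} tt
  ; loopless = toWitness {a? = all? λ i → a i i ℤₚ.≟ 0ℤ} tt
  }
  where
  a : Fin 5 → Fin 5 → ℤ
  a i j = Vec.lookup (Vec.lookup
    ((0ℤ ∷ 1ℤ ∷ 1ℤ ∷ 1ℤ ∷ 1ℤ ∷ []) ∷
     (1ℤ ∷ 0ℤ ∷ -1ℤ ∷ 0ℤ ∷ 0ℤ ∷ []) ∷
     (1ℤ ∷ -1ℤ ∷ 0ℤ ∷ 0ℤ ∷ 0ℤ ∷ []) ∷
     (1ℤ ∷ 0ℤ ∷ 0ℤ ∷ 0ℤ ∷ -1ℤ ∷ []) ∷
     (1ℤ ∷ 0ℤ ∷ 0ℤ ∷ -1ℤ ∷ 0ℤ ∷ []) ∷ []) i) j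

bowtie-inBpp : InBpp bowtie
bowtie-inBpp = (connected , refl) , triangle 1F 2F (λ ()) (λ ()) (λ ()) (λ ()) (λ ()) (λ ()) ,
  triangle 3F 4F (λ ()) (λ ()) (λ ()) (λ ()) (λ ()) (λ ()) , 0F , here refl , here refl , meet
  where
  connected : Connected bowtie
  connected i j = concat (inward i) (outward j)
    where
    concat : ∀ {i j k} → Walk bowtie i j → Walk bowtie j k → Walk bowtie i k
    concat here          w = w
    concat (step i∼l w′) w = step i∼l (concat w′ w)
    inward : ∀ i → Walk bowtie i 0F
    inward 0F = here
    inward 1F = step (λ ()) here
    inward 2F = step (λ ()) here
    inward 3F = step (λ ()) here
    inward 4F = step (λ ()) here
    outward : ∀ j → Walk bowtie 0F j
    outward 0F = here
    outward 1F = step (λ ()) here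
    outward 2F = step (λ ()) here
    outward 3F = step (λ ()) here
    outward 4F = step (λ ()) here
  triangle : ∀ a b → 0F ≢ a → 0F ≢ b → a ≢ b →
             Adj bowtie 0F a → Adj bowtie a b → Adj bowtie b 0F → Cycle bowtie
  triangle a b 0≢a 0≢b a≢b 0∼a a∼b b∼0 = record
    { vertices = 0F ∷ a ∷ b ∷ []
    ; distinct = (0≢a ∷ 0≢b ∷ []) ∷ (a≢b ∷ []) ∷ [] ∷ []
    ; len≥3    = ℕₚ.≤-refl
    ; closed   = 0F , a ∷ b ∷ [] , refl , 0∼a , a∼b , b∼0 , tt
    }
  meet : ∀ w → w ∈ 0F ∷ 1F ∷ 2F ∷ [] → w ∈ 0F ∷ 3F ∷ 4F ∷ [] → w ≡ 0F
  meet 0F _ _ = refl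
  meet 1F _ (here ())
  meet 1F _ (there (here ()))
  meet 1F _ (there (there (here ())))
  meet 2F _ (here ())
  meet 2F _ (there (here ()))
  meet 2F _ (there (there (here ())))
  meet 3F (here ()) _
  meet 3F (there (here ())) _
  meet 3F (there (there (here ()))) _
  meet 4F (here ()) _
  meet 4F (there (here ())) _
  meet 4F (there (there (here ()))) _

bowtie-unbalanced : Unbalanced bowtie
bowtie-unbalanced balanced with () ← balanced (proj₁ (proj₂ bowtie-inBpp))

record Hub (n : ℕ) : Set where
  field
    graph       : SignedGraph n
    hub         : Fin n
    inBpp       : InBpp graph
    unbalanced  : Unbalanced graph
    nonsingular∖ : φ∖ graph hub 0 ≢ 0ℤ

addTwig : ∀ {n} → Hub n → Hub (2 ℕ.+ n)
addTwig H = record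
  { graph        = addLeaf (addLeaf graph hub) zero
  ; hub          = suc (suc hub)
  ; inBpp        = inBpp-leaf (addLeaf graph hub) zero (inBpp-leaf graph hub inBpp)
  ; unbalanced   = unbalanced-leaf (addLeaf graph hub) zero (unbalanced-leaf graph hub unbalanced)
  ; nonsingular∖ = λ eq → nonsingular∖ (ℤₚ.neg-injective (trans (sym (φ∖-twig graph hub)) eq))
  }
  where open Hub H

addTwigs : ∀ {n} t → Hub n → Hub (t ℕ.* 2 ℕ.+ n)
addTwigs zero    H = H
addTwigs (suc t) H = addTwig (addTwigs t H)

-- Without the centre two disjoint edges remain, of determinant (-1)(-1) = 1.
hub₅ : Hub 5
hub₅ = record
  { graph = bowtie ; hub = zero ; inBpp = bowtie-inBpp ; unbalanced = bowtie-unbalanced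
  ; nonsingular∖ = λ () }

-- The hub is the new leaf, so what remains is the bowtie itself. Its adjacency determinant is a sum
-- of one term per triangle, -2 times the sign of that triangle: for two negative triangles it is 4,
-- whereas opposite signs would cancel.
hub₆ : Hub 6
hub₆ = record
  { graph = addLeaf bowtie zero ; hub = zero ; inBpp = inBpp-leaf bowtie zero bowtie-inBpp
  ; unbalanced = unbalanced-leaf bowtie zero bowtie-unbalanced
  ; nonsingular∖ = λ () }

-- With s + 1 leaves at the hub, φ = xˢ⁺¹ φ₀ - (s + 1) xˢ c and φ∖ = xˢ⁺¹ c, where φ₀ and c
-- belong to the graph without these leaves; only the coefficients up to s matter.
record Leafy (s n : ℕ) (c : ℤ) : Set where
  field
    graph      : SignedGraph n
    hub        : Fin n
    inBpp      : InBpp graph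
    unbalanced : Unbalanced graph
    φ-low      : ∀ j → j < s → φ graph j ≡ 0ℤ
    φ-at       : φ graph s ≡ - (+ suc s * c)
    φ∖-low     : ∀ j → j < suc s → φ∖ graph hub j ≡ 0ℤ
    φ∖-at      : φ∖ graph hub (suc s) ≡ c

shift-suc : ∀ f j → ((0ℤ , 1ℤ) ▷ f) (suc j) ≡ f j
shift-suc f j = trans (ℤₚ.+-identityˡ _) (ℤₚ.*-identityˡ (f j))

leafy : ∀ {n} s (H : Hub n) → Leafy s (suc s ℕ.+ n) (φ∖ (Hub.graph H) (Hub.hub H) 0)
leafy zero H = record
  { graph      = addLeaf graph hub
  ; hub        = suc hub
  ; inBpp      = inBpp-leaf graph hub inBpp
  ; unbalanced = unbalanced-leaf graph hub unbalanced
  ; φ-low      = λ _ ()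
  ; φ-at       = trans (φ-leaf graph hub 0) (trans (ℤₚ.+-identityˡ _) (cong -_ (sym (ℤₚ.*-identityˡ _))))
  ; φ∖-low     = λ { zero _ → φ∖-leaf graph hub zero ; (suc j) (s≤s ()) }
  ; φ∖-at      = trans (φ∖-leaf graph hub 1) (shift-suc (φ∖ graph hub) 0)
  }
  where open Hub H
leafy (suc s) H = record
  { graph      = addLeaf graph hub
  ; hub        = suc hub
  ; inBpp      = inBpp-leaf graph hub inBpp
  ; unbalanced = unbalanced-leaf graph hub unbalanced
  ; φ-low      = low
  ; φ-at       = begin
      φ (addLeaf graph hub) (suc s)
        ≡⟨ φ-leaf graph hub (suc s) ⟩
      ((0ℤ , 1ℤ) ▷ φ graph) (suc s) + - φ∖ graph hub (suc s)
        ≡⟨ cong₂ (λ x y → x + - y) (trans (shift-suc (φ graph) s) φ-at) φ∖-at ⟩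
      - (+ suc s * c) + - c
        ≡⟨ eq (+ suc s) c ⟩
      - (ℤ.suc (+ suc s) * c)                                    ∎
  ; φ∖-low     = λ { zero _ → φ∖-leaf graph hub zero
                   ; (suc j) (s≤s j<) → trans (φ∖-leaf graph hub (suc j))
                                            (trans (shift-suc (φ∖ graph hub) j) (φ∖-low j j<)) }
  ; φ∖-at      = trans (φ∖-leaf graph hub (suc (suc s))) (trans (shift-suc (φ∖ graph hub) (suc s)) φ∖-at)
  }
  where
  open ≡-Reasoning
  open Leafy (leafy s H)
  c = φ∖ (Hub.graph H) (Hub.hub H) 0
  eq : ∀ k c → - (k * c) + - c ≡ - ((1ℤ + k) * c)
  eq = solve-∀
  low : ∀ j → j < suc s → φ (addLeaf graph hub) j ≡ 0ℤ
  low zero    j< = trans (φ-leaf graph hub zero) (trans (ℤₚ.+-identityˡ _) (cong -_ (φ∖-low 0 j<)))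
  low (suc j) j< = trans (φ-leaf graph hub (suc j))
    (cong₂ (λ x y → x + - y) (trans (shift-suc (φ graph) j) (φ-low j (s≤s⁻¹ j<))) (φ∖-low (suc j) j<))

Realizes : ℕ → ℕ → Set
Realizes n k = Σ (SignedGraph n) λ Γ → InBpp Γ × Unbalanced Γ × η Γ ≡ k

realize : ∀ {n} k → Hub n → Realizes (suc k ℕ.+ n) k
realize k H = graph , inBpp , unbalanced ,
  mult0-unique (charPoly graph) k
    (λ j j<k → trans (charPoly-D graph j) (φ-low j j<k))
    (λ eq → [ (λ ()) , Hub.nonsingular∖ H ]′ (ℤₚ.i*j≡0⇒i≡0∨j≡0 (+ suc k)
      (ℤₚ.neg-injective (trans (sym φ-at) (trans (sym (charPoly-D graph k)) eq)))))
  where open Leafy (leafy k H)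

-- The bowtie and k + 1 leaves use k + 6 vertices, whence the bound n - 6. The other n - 6 - k are
-- supplied in pairs by twigs, and an odd one by starting from `hub₆`.
realize-all : ∀ n k → 8 ≤ n → k ≤ n ∸ 6 → Realizes n k
realize-all n k 8≤n k≤ with (n ∸ 6 ∸ k) divMod 2
... | result t 0F d≡ = subst (λ m → Realizes m k) size (realize k (addTwigs t hub₅))
  where
  size : suc k ℕ.+ (t ℕ.* 2 ℕ.+ 5) ≡ n
  size = begin
    suc k ℕ.+ (t ℕ.* 2 ℕ.+ 5)      ≡⟨ eq k (t ℕ.* 2) ⟩
    6 ℕ.+ (k ℕ.+ t ℕ.* 2)          ≡⟨ cong (λ d → 6 ℕ.+ (k ℕ.+ d)) d≡ ⟨
    6 ℕ.+ (k ℕ.+ (n ∸ 6 ∸ k))  ≡⟨ cong (6 ℕ.+_) (ℕₚ.m+[n∸m]≡n k≤) ⟩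
    6 ℕ.+ (n ∸ 6)                ≡⟨ ℕₚ.m+[n∸m]≡n (ℕₚ.≤-trans (ℕₚ.m≤m+n 6 2) 8≤n) ⟩
    n                              ∎
    where
    open ≡-Reasoning
    eq : ∀ k d → suc k ℕ.+ (d ℕ.+ 5) ≡ 6 ℕ.+ (k ℕ.+ d)
    eq = ℕ-Solver.solve-∀
... | result t 1F d≡ = subst (λ m → Realizes m k) size (realize k (addTwigs t hub₆))
  where
  size : suc k ℕ.+ (t ℕ.* 2 ℕ.+ 6) ≡ n
  size = begin
    suc k ℕ.+ (t ℕ.* 2 ℕ.+ 6)      ≡⟨ eq k (t ℕ.* 2) ⟩
    6 ℕ.+ (k ℕ.+ suc (t ℕ.* 2))    ≡⟨ cong (λ d → 6 ℕ.+ (k ℕ.+ d)) d≡ ⟨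
    6 ℕ.+ (k ℕ.+ (n ∸ 6 ∸ k))  ≡⟨ cong (6 ℕ.+_) (ℕₚ.m+[n∸m]≡n k≤) ⟩
    6 ℕ.+ (n ∸ 6)                ≡⟨ ℕₚ.m+[n∸m]≡n (ℕₚ.≤-trans (ℕₚ.m≤m+n 6 2) 8≤n) ⟩
    n                              ∎
    where
    open ≡-Reasoning
    eq : ∀ k d → suc k ℕ.+ (d ℕ.+ 6) ≡ 6 ℕ.+ (k ℕ.+ suc d)
    eq = ℕ-Solver.solve-∀

theorem5p6 : (n : ℕ) → 8 ≤ n → (k : ℕ) →
    (Σ (SignedGraph n) λ Γ → InBpp Γ × Unbalanced Γ × η Γ ≡ k) ⇔ (k ≤ n ∸ 6)
theorem5p6 n 8≤n k = mk⇔
  (λ (Γ , inBpp , _ , η≡k) → subst (_≤ n ∸ 6) η≡k (η-upper Γ inBpp 8≤n))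
  (realize-all n k 8≤n)
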